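{- There is a polynomial time algorithm which, on input $\Gamma$, a finite set of ground term equations, and $t$, a ground term, outputs the size of the $\sim_\Gamma$-congruence class of $t$ (possibly $\infty$).
   Context: $\Sigma$ is a finite functional signature having function symbols (of positive arity) and constant symbols. A ground term is a term built only from constants and function symbols of $\Sigma$; $\mathcal{F}$ is the algebra of all ground terms. A ground term equation is an expression $p=q$ with $p,q$ ground terms. For a finite set $\Gamma$ of ground term equations, $\sim_\Gamma$ is the congruence on $\mathcal{F}$ given by $p\sim_\Gamma q$ iff $\Gamma\vdash p=q$ (equivalently, the smallest congruence on $\mathcal{F}$ containing all pairs $(p,q)$ with $p=q$ in $\Gamma$). The size of the $\sim_\Gamma$-congruence class of $t$ is the number of ground terms $s$ with $s\sim_\Gamma t$, or $\infty$ if there are infinitely many. The size $|t|$ of a ground term $t$ is the number of nodes of its syntax tree, and $|\Gamma|=\sum_{(p=q)\in\Gamma}(|p|+|q|)$. Polynomial time means polynomial in $|\Gamma|$ and $|t|$.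
   Formalization: The size may be doubly exponential in |Γ|, so its binary output can need exponential time; polynomial time here counts each addition or multiplication of natural numbers as one step, and these numbers can never be tested or compared. -}

module Defs where

open import Data.Fin using (Fin; zero; suc)
open import Data.List using (List; []; _∷_; map; sum)
open import Data.List.Membership.Propositional using (_∈_)
open import Data.Nat using (ℕ; zero; suc; _+_; _*_)
open import Data.Product using (_×_; _,_; proj₁; ∃-syntax)
open import Data.Vec using (Vec; []; _∷_; lookup)
open import Data.Vec.Relation.Binary.Pointwise.Inductive using (Pointwise)
open import Function.Bundles using (Bijection; Injection)
open import Level using (0ℓ)
open import Relation.Binary.Bundles using (Setoid)
open import Relation.Binary.PropositionalEquality using (setoid)
import Relation.Binary.Construct.On as On

------------------------------------------------------------------------
-- Ground terms and ground term equations

-- Symbols of arity 0 are the constants.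
record Signature : Set where
  field
    #symbols : ℕ
    arity    : Fin #symbols → ℕ

open Signature public

data Term (S : Signature) : Set where
  app : (f : Fin (#symbols S)) → Vec (Term S) (arity S f) → Term S

Equation : Signature → Set
Equation S = Term S × Term S

Equations : Signature → Set
Equations S = List (Equation S)

module _ {S : Signature} where

  mutual
    ∣_∣ᵗ : Term S → ℕ
    ∣ app _ ts ∣ᵗ = suc ∣ ts ∣ᵗˢ

    ∣_∣ᵗˢ : ∀ {n} → Vec (Term S) n → ℕ
    ∣ [] ∣ᵗˢ     = 0
    ∣ t ∷ ts ∣ᵗˢ = ∣ t ∣ᵗ + ∣ ts ∣ᵗˢ

  ∣_∣ᴳ : Equations S → ℕ
  ∣ Γ ∣ᴳ = sum (map (λ { (p , q) → ∣ p ∣ᵗ + ∣ q ∣ᵗ }) Γ)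

  infix 4 _⊢_∼_

  data _⊢_∼_ (Γ : Equations S) : Term S → Term S → Set where
    axiom : ∀ {p q} → (p , q) ∈ Γ → Γ ⊢ p ∼ q
    refl  : ∀ {p} → Γ ⊢ p ∼ p
    sym   : ∀ {p q} → Γ ⊢ p ∼ q → Γ ⊢ q ∼ p
    trans : ∀ {p q r} → Γ ⊢ p ∼ q → Γ ⊢ q ∼ r → Γ ⊢ p ∼ r
    cong  : ∀ f {ps qs} → Pointwise (Γ ⊢_∼_) ps qs → Γ ⊢ app f ps ∼ app f qs

  -- The elements of the class are terms, compared as terms: the derivation
  -- of s ∼ t is ignored, since one pair may have many derivations.
  CongruenceClass : Equations S → Term S → Setoid 0ℓ 0ℓ
  CongruenceClass Γ t = On.setoid {B = ∃[ s ] Γ ⊢ s ∼ t} (setoid (Term S)) proj₁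

data Size : Set where
  fin : ℕ → Size
  ∞   : Size

data HasSize (A : Setoid 0ℓ 0ℓ) : Size → Set where
  finite   : ∀ {n} → Bijection (setoid (Fin n)) A → HasSize A (fin n)
  infinite : Injection (setoid ℕ) A → HasSize A ∞

------------------------------------------------------------------------
-- Algorithms

-- Algorithms are programs of a first-order call-by-value functional language
-- (pure first-order Lisp) with unit cost per evaluation step.  Values are
-- binary trees; on these, polynomial time is the usual polynomial time.
--
-- The size of a finite congruence class can be doubly exponential in the
-- input, so that writing it in binary would already take exponential time:
-- with c, d constants, g unary, f binary, the equations c = d and
-- f(gⁱc, gⁱc) = gⁱ⁺¹c for i < n make the class of gⁿc finite, of size at least
-- 2^(2^n).  Hence natural numbers are atomic values on which addition and
-- multiplication take one step.  No construct inspects these atoms (`match`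
-- does not even separate them from `nil`), so that arithmetic can only be used
-- to produce the output, not to speed up the rest of the computation.
data Value : Set where
  nil : Value
  _▹_ : Value → Value → Value
  num : ℕ → Value

infixr 5 _▹_

-- Expressions with n variables (de Bruijn), over k procedures of arities ar.
data Expr {k : ℕ} (ar : Fin k → ℕ) (n : ℕ) : Set where
  var   : Fin n → Expr ar n
  nil   : Expr ar n
  _▹_   : Expr ar n → Expr ar n → Expr ar n
  match : Expr ar n → (pair : Expr ar (2 + n)) (otherwise : Expr ar n) → Expr ar n
  bind  : Expr ar n → Expr ar (suc n) → Expr ar n
  call  : (f : Fin k) → Vec (Expr ar n) (ar f) → Expr ar n
  num   : ℕ → Expr ar n
  add   : Expr ar n → Expr ar n → Expr ar n
  mul   : Expr ar n → Expr ar n → Expr ar n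

record Program : Set where
  field
    #procedures : ℕ
    params      : Fin #procedures → ℕ
    body        : (f : Fin #procedures) → Expr params (params f)
    main        : Expr params 1

open Program public

-- P , ρ ⊢ e ⇓ v ⟨ τ ⟩ : in the environment ρ, the expression e evaluates to v
-- in exactly τ steps.
infix 4 _,_⊢_⇓_⟨_⟩ _,_⊢_⇓*_⟨_⟩

mutual
  data _,_⊢_⇓_⟨_⟩ (P : Program) {n : ℕ} (ρ : Vec Value n) :
                   Expr (params P) n → Value → ℕ → Set where
    var : ∀ x → P , ρ ⊢ var x ⇓ lookup ρ x ⟨ 1 ⟩
    nil : P , ρ ⊢ nil ⇓ nil ⟨ 1 ⟩
    _▹_ : ∀ {e₁ e₂ v₁ v₂ τ₁ τ₂} →
          P , ρ ⊢ e₁ ⇓ v₁ ⟨ τ₁ ⟩ →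
          P , ρ ⊢ e₂ ⇓ v₂ ⟨ τ₂ ⟩ →
          P , ρ ⊢ e₁ ▹ e₂ ⇓ v₁ ▹ v₂ ⟨ suc (τ₁ + τ₂) ⟩
    match-pair : ∀ {e e₁ e₂ v₁ v₂ v τ₁ τ₂} →
          P , ρ ⊢ e ⇓ v₁ ▹ v₂ ⟨ τ₁ ⟩ →
          P , v₁ ∷ v₂ ∷ ρ ⊢ e₁ ⇓ v ⟨ τ₂ ⟩ →
          P , ρ ⊢ match e e₁ e₂ ⇓ v ⟨ suc (τ₁ + τ₂) ⟩
    match-nil : ∀ {e e₁ e₂ v τ₁ τ₂} →
          P , ρ ⊢ e ⇓ nil ⟨ τ₁ ⟩ →
          P , ρ ⊢ e₂ ⇓ v ⟨ τ₂ ⟩ →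
          P , ρ ⊢ match e e₁ e₂ ⇓ v ⟨ suc (τ₁ + τ₂) ⟩
    match-num : ∀ {e e₁ e₂ m v τ₁ τ₂} →
          P , ρ ⊢ e ⇓ num m ⟨ τ₁ ⟩ →
          P , ρ ⊢ e₂ ⇓ v ⟨ τ₂ ⟩ →
          P , ρ ⊢ match e e₁ e₂ ⇓ v ⟨ suc (τ₁ + τ₂) ⟩
    bind : ∀ {e₁ e₂ v₁ v₂ τ₁ τ₂} →
          P , ρ ⊢ e₁ ⇓ v₁ ⟨ τ₁ ⟩ →
          P , v₁ ∷ ρ ⊢ e₂ ⇓ v₂ ⟨ τ₂ ⟩ →
          P , ρ ⊢ bind e₁ e₂ ⇓ v₂ ⟨ suc (τ₁ + τ₂) ⟩
    call : ∀ f {es vs v τ₁ τ₂} →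
          P , ρ ⊢ es ⇓* vs ⟨ τ₁ ⟩ →
          P , vs ⊢ body P f ⇓ v ⟨ τ₂ ⟩ →
          P , ρ ⊢ call f es ⇓ v ⟨ suc (τ₁ + τ₂) ⟩
    num : ∀ m → P , ρ ⊢ num m ⇓ num m ⟨ 1 ⟩
    add : ∀ {e₁ e₂ m₁ m₂ τ₁ τ₂} →
          P , ρ ⊢ e₁ ⇓ num m₁ ⟨ τ₁ ⟩ →
          P , ρ ⊢ e₂ ⇓ num m₂ ⟨ τ₂ ⟩ →
          P , ρ ⊢ add e₁ e₂ ⇓ num (m₁ + m₂) ⟨ suc (τ₁ + τ₂) ⟩
    mul : ∀ {e₁ e₂ m₁ m₂ τ₁ τ₂} →
          P , ρ ⊢ e₁ ⇓ num m₁ ⟨ τ₁ ⟩ →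
          P , ρ ⊢ e₂ ⇓ num m₂ ⟨ τ₂ ⟩ →
          P , ρ ⊢ mul e₁ e₂ ⇓ num (m₁ * m₂) ⟨ suc (τ₁ + τ₂) ⟩

  data _,_⊢_⇓*_⟨_⟩ (P : Program) {n : ℕ} (ρ : Vec Value n) :
                    ∀ {k} → Vec (Expr (params P) n) k → Vec Value k → ℕ → Set where
    []  : P , ρ ⊢ [] ⇓* [] ⟨ 0 ⟩
    _∷_ : ∀ {k e v τ₁ τ₂} {es : Vec (Expr (params P) n) k} {vs} →
          P , ρ ⊢ e ⇓ v ⟨ τ₁ ⟩ →
          P , ρ ⊢ es ⇓* vs ⟨ τ₂ ⟩ →
          P , ρ ⊢ e ∷ es ⇓* v ∷ vs ⟨ τ₁ + τ₂ ⟩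

Runs : Program → (input output : Value) (time : ℕ) → Set
Runs P input output time = P , input ∷ [] ⊢ main P ⇓ output ⟨ time ⟩

------------------------------------------------------------------------
-- Input and output encodings

-- Unary; for a fixed signature the codes of symbols have bounded size.
encodeSymbol : ∀ {k} → Fin k → Value
encodeSymbol zero    = nil
encodeSymbol (suc f) = nil ▹ encodeSymbol f

module _ {S : Signature} where

  mutual
    encodeTerm : Term S → Value
    encodeTerm (app f ts) = encodeSymbol f ▹ encodeTerms ts

    encodeTerms : ∀ {n} → Vec (Term S) n → Value
    encodeTerms []       = nil
    encodeTerms (t ∷ ts) = encodeTerm t ▹ encodeTerms ts

  encodeEquations : Equations S → Value
  encodeEquations []            = nil
  encodeEquations ((p , q) ∷ Γ) = (encodeTerm p ▹ encodeTerm q) ▹ encodeEquations Γ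

  encodeInput : Equations S → Term S → Value
  encodeInput Γ t = encodeEquations Γ ▹ encodeTerm t

encodeSize : Size → Value
encodeSize (fin n) = num n
encodeSize ∞       = nil

{-# OPTIONS --safe #-}

-- Regard a pair (f(t₁,…,tₙ) , t) of terms as a rule f(t₁,…,tₙ) → t of a
-- bottom-up tree automaton whose states are named by terms.  Start with the
-- equations of Γ and with the rules s → s for all subterms s.  As long as two
-- rules l → a and l → b have the same left-hand side, delete the first one and
-- replace the state a by b everywhere.  Each step deletes a rule, and the result
-- is deterministic.  Every state stands for a congruence class: stuck runs are
-- preserved by congruence, so that Γ ⊢ s ∼ t exactly if s runs to the state of t.
--
-- The number of terms that run to a state c is the sum over the rules
-- f(c₁,…,cₙ) → c of the products of the numbers for c₁,…,cₙ.  A state is entered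
-- into a table as soon as all arguments of its rules are there.
-- When this stops, each missing state has a rule with a missing argument; since
-- every state is reached by some term, such a state has arbitrarily large terms.
module Submission where

open import Defs
open import Data.Nat using (ℕ; _+_; _*_; _^_; _≤_)
open import Data.Product using (_×_; ∃-syntax)

open import Data.Bool using (Bool; if_then_else_) renaming (true to tt; false to ff)
open import Data.Fin as Fin using (Fin; zero; suc)
open import Data.Fin.Patterns
open import Data.Fin.Properties using (all?)
open import Data.List using (List; []; _∷_; _++_; length; map; filter; cartesianProductWith)
open import Data.List.Membership.Propositional using (_∈_)
open import Data.List.Membership.Propositional.Properties
  using (∈-map⁺; ∈-map⁻; ∈-++⁺ˡ; ∈-++⁺ʳ; ∈-++⁻; ∈-filter⁺; ∈-lookup; ∈-cartesianProductWith⁺; ∈-cartesianProductWith⁻)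
open import Data.List.Properties using (++-assoc; length-map; length-++; filter-notAll)
open import Data.List.Relation.Unary.All as All using (All; []; _∷_)
open import Data.List.Relation.Unary.AllPairs using ([]; _∷_)
open import Data.List.Relation.Unary.Any as Any using (here; there; index)
open import Data.List.Relation.Unary.Any.Properties using (lookup-index)
open import Data.List.Relation.Unary.Unique.Propositional using (Unique)
import Data.List.Relation.Unary.Unique.Propositional.Properties as Unique
open import Data.Maybe as Maybe using (Maybe; just; nothing; zipWith; _>>=_)
open import Data.Maybe.Properties using (just-injective)
open import Data.Nat using (zero; suc; _<_; z≤n; s≤s; _≤?_)
open import Data.Nat.ListAction using (sum)
open import Data.Nat.ListAction.Properties using (sum-++)
open import Data.Nat.Properties hiding (_≟_)
open import Data.Nat.Tactic.RingSolver using (solve-∀)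
open import Data.Product as Product using (_,_; proj₁; proj₂)
open import Data.Sum as Sum using (_⊎_; inj₁; inj₂)
open import Data.Vec as Vec using (Vec; []; _∷_; lookup; _[_]≔_)
open import Data.Vec.Properties using (map-id; map-∘; lookup-map; ∷-injective)
open import Data.Vec.Relation.Binary.Pointwise.Inductive using (Pointwise; []; _∷_)
open import Data.Vec.Relation.Unary.All as VAll using ([]; _∷_) renaming (All to AllV)
open import Data.Vec.Relation.Unary.All.Properties using (lookup⁺)
open import Function using (_∘_; id)
open import Relation.Binary.Definitions using (tri<; tri≈; tri>)
open import Relation.Binary.PropositionalEquality as ≡ using (_≡_; refl; _≢_)
open import Relation.Nullary using (Dec; yes; no; does; contradiction; ¬?)
open import Relation.Nullary.Decidable using (from-yes; map′; _×-dec_)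

-- The program

-- The merging is congruence closure. An equation `p = q` gives a rule from `p` to `q` beside the
-- rule from `p` to itself, a conflict whose removal identifies the two states; and two applications
-- with congruent arguments come into conflict once their arguments have been renamed alike. The
-- obstacle is size, since the renaming `σ` composes many substitutions. Names of states do not
-- grow, because a merge replaces a name by one that is already in use, and a left-hand side keeps
-- its root symbol and is renamed only in its arguments. With `N = ∣Γ∣ + ∣t∣`, every name thus has
-- at most `N` nodes and every left-hand side at most `1 + N * N`. Infinity is not recognised by
-- finding a cycle: rules with missing arguments are followed as often as the wanted size demands,
-- and the other arguments are filled with initial terms that run to their states. One program
-- serves all signatures; the signature enters only the time bound, through the size of the codes of
-- symbols.

pattern eqᶠ       = zero
pattern lookupᶠ   = suc eqᶠ
pattern findᶠ     = suc lookupᶠ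
pattern subᶠ      = suc findᶠ
pattern subArgsᶠ  = suc subᶠ
pattern subRulesᶠ = suc subArgsᶠ
pattern closeᶠ    = suc subRulesᶠ
pattern productᶠ  = suc closeᶠ
pattern totalᶠ    = suc productᶠ
pattern readyᶠ    = suc totalᶠ
pattern tableᶠ    = suc readyᶠ
pattern diagᶠ     = suc tableᶠ
pattern diagsᶠ    = suc diagᶠ
pattern initialᶠ  = suc diagsᶠ

arities : Fin 14 → ℕ
arities eqᶠ       = 2
arities lookupᶠ   = 2
arities findᶠ     = 1
arities subᶠ      = 3
arities subArgsᶠ  = 3
arities subRulesᶠ = 3
arities closeᶠ    = 2
arities productᶠ  = 2
arities totalᶠ    = 3
arities readyᶠ    = 3
arities tableᶠ    = 2
arities diagᶠ     = 2
arities diagsᶠ    = 2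
arities initialᶠ  = 2

true false : ∀ {n} → Expr arities n
true  = nil ▹ nil
false = nil

-- `match` pushes the head as variable 0 and the tail as variable 1.
-- Optional values are encoded as nil and x ▹ nil, booleans as nil and nil ▹ nil.
bodies : (f : Fin 14) → Expr arities (arities f)
-- eq x y
bodies eqᶠ =
  match (var 0F)
    (match (var 3F)
      (match (call eqᶠ (var 2F ∷ var 0F ∷ []))
        (call eqᶠ (var 5F ∷ var 3F ∷ []))
        false)
      false)
    (match (var 1F) false true)
-- lookup k xs
bodies lookupᶠ =
  match (var 1F)
    (match (var 0F)
      (match (call eqᶠ (var 4F ∷ var 0F ∷ []))
        (var 3F ▹ nil)
        (call lookupᶠ (var 4F ∷ var 3F ∷ [])))
      nil)
    nil
-- find Δ
bodies findᶠ =
  match (var 0F)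
    (match (var 0F)
      (match (call lookupᶠ (var 0F ∷ var 3F ∷ []))
        ((var 3F ▹ var 0F) ▹ var 5F)
        (match (call findᶠ (var 3F ∷ []))
          (var 0F ▹ (var 4F ▹ var 1F))
          nil))
      nil)
    nil
-- sub a b x
bodies subᶠ =
  match (call eqᶠ (var 0F ∷ var 2F ∷ []))
    (var 3F)
    (var 2F)
-- subArgs a b xs
bodies subArgsᶠ =
  match (var 2F)
    (call subᶠ (var 2F ∷ var 3F ∷ var 0F ∷ []) ▹ call subArgsᶠ (var 2F ∷ var 3F ∷ var 1F ∷ []))
    nil
-- subRules a b Δ
bodies subRulesᶠ =
  match (var 2F)
    (match (var 0F)
      (match (var 0F)
        (((var 0F ▹ call subArgsᶠ (var 6F ∷ var 7F ∷ var 1F ∷ []))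
           ▹ call subᶠ (var 6F ∷ var 7F ∷ var 3F ∷ []))
          ▹ call subRulesᶠ (var 6F ∷ var 7F ∷ var 5F ∷ []))
        nil)
      nil)
    nil
-- close Δ t
bodies closeᶠ =
  match (call findᶠ (var 0F ∷ []))
    (match (var 0F)
      (call closeᶠ (call subRulesᶠ (var 0F ∷ var 1F ∷ var 3F ∷ [])
                  ∷ call subᶠ (var 0F ∷ var 1F ∷ var 5F ∷ []) ∷ []))
      nil)
    (var 0F ▹ var 1F)
-- product D ts
bodies productᶠ =
  match (var 1F)
    (match (call lookupᶠ (var 0F ∷ var 2F ∷ []))
      (match (call productᶠ (var 4F ∷ var 3F ∷ []))
        (mul (var 2F) (var 0F) ▹ nil)
        nil)
      nil)
    (num 1 ▹ nil)
-- total D c Δ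
bodies totalᶠ =
  match (var 2F)
    (match (var 0F)
      (match (call eqᶠ (var 5F ∷ var 1F ∷ []))
        (match (var 2F)
          (match (call productᶠ (var 8F ∷ var 1F ∷ []))
            (match (call totalᶠ (var (suc 9F) ∷ var (suc (suc 9F)) ∷ var 9F ∷ []))
              (add (var 2F) (var 0F) ▹ nil)
              nil)
            nil)
          nil)
        (call totalᶠ (var 4F ∷ var 5F ∷ var 3F ∷ [])))
      nil)
    (num 0 ▹ nil)
-- ready D Δ Δ′
bodies readyᶠ =
  match (var 2F)
    (match (var 0F)
      (match (call lookupᶠ (var 1F ∷ var 4F ∷ []))
        (call readyᶠ (var 6F ∷ var 7F ∷ var 5F ∷ []))
        (match (call totalᶠ (var 4F ∷ var 1F ∷ var 5F ∷ []))
          ((var 3F ▹ var 0F) ▹ nil)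
          (call readyᶠ (var 4F ∷ var 5F ∷ var 3F ∷ []))))
      nil)
    nil
-- table D Δ
bodies tableᶠ =
  match (call readyᶠ (var 0F ∷ var 1F ∷ var 1F ∷ []))
    (call tableᶠ ((var 0F ▹ var 2F) ∷ var 3F ∷ []))
    (var 0F)
-- diag t Δ
bodies diagᶠ =
  match (var 0F)
    ((var 2F ▹ var 2F) ▹ call diagsᶠ (var 1F ∷ var 3F ∷ []))
    nil
-- diags ts Δ
bodies diagsᶠ =
  match (var 0F)
    (call diagᶠ (var 0F ∷ call diagsᶠ (var 1F ∷ var 3F ∷ []) ∷ []))
    (var 1F)
-- initial Γ Δ
bodies initialᶠ =
  match (var 0F)
    (match (var 0F)
      ((var 0F ▹ var 1F) ▹
        call diagᶠ (var 0F ∷ call diagᶠ (var 1F ∷ call initialᶠ (var 3F ∷ var 5F ∷ []) ∷ []) ∷ []))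
      nil)
    (var 1F)

countProgram : Program
countProgram = record
  { #procedures = 14
  ; params      = arities
  ; body        = bodies
  ; main        =
      match (var 0F)
        (match (call closeᶠ (call initialᶠ (var 0F ∷ call diagᶠ (var 1F ∷ nil ∷ []) ∷ []) ∷ var 1F ∷ []))
          (match (call lookupᶠ (var 1F ∷ call tableᶠ (nil ∷ var 0F ∷ []) ∷ []))
            (var 0F)
            nil)
          nil)
        nil
  }

-- Cost

mutual
  ‖_‖ : ∀ {n} → Expr arities n → ℕ
  ‖ var _ ‖         = 1
  ‖ nil ‖           = 1
  ‖ e₁ ▹ e₂ ‖       = suc (‖ e₁ ‖ + ‖ e₂ ‖)
  ‖ match e e₁ e₂ ‖ = suc (‖ e ‖ + (‖ e₁ ‖ + ‖ e₂ ‖))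
  ‖ bind e₁ e₂ ‖    = suc (‖ e₁ ‖ + ‖ e₂ ‖)
  ‖ call _ es ‖     = suc ‖ es ‖*
  ‖ num _ ‖         = 1
  ‖ add e₁ e₂ ‖     = suc (‖ e₁ ‖ + ‖ e₂ ‖)
  ‖ mul e₁ e₂ ‖     = suc (‖ e₁ ‖ + ‖ e₂ ‖)

  ‖_‖* : ∀ {n k} → Vec (Expr arities n) k → ℕ
  ‖ [] ‖*     = 0
  ‖ e ∷ es ‖* = ‖ e ‖ + ‖ es ‖*

abstract
  -- Any bound on the number of nodes of the bodies would do; this one is checked by evaluation. It
  -- is opaque so that a product with it does not unfold into fifty summands.
  bodySize : ℕ
  bodySize = 50

  ‖body‖≤ : ∀ f → ‖ bodies f ‖ ≤ bodySize
  ‖body‖≤ = from-yes (all? λ f → ‖ bodies f ‖ ≤? bodySize)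

-- Since a body is evaluated without loops, the time is at most proportional to
-- the number of procedure calls; ks lists the number of calls made (including
-- itself) by each call that e makes directly.
record Eval {n} (ρ : Vec Value n) (e : Expr arities n) (v : Value) (ks : List ℕ) : Set where
  constructor eval
  field
    {time}     : ℕ
    derivation : countProgram , ρ ⊢ e ⇓ v ⟨ time ⟩
    time≤      : time ≤ ‖ e ‖ + bodySize * sum ks

record Evals {n k} (ρ : Vec Value n) (es : Vec (Expr arities n) k) (vs : Vec Value k) (ks : List ℕ) : Set where
  constructor evals
  field
    {time}     : ℕ
    derivation : countProgram , ρ ⊢ es ⇓* vs ⟨ time ⟩
    time≤      : time ≤ ‖ es ‖* + bodySize * sum ks

record Call (f : Fin 14) (vs : Vec Value (arities f)) (v : Value) (k : ℕ) : Set where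
  constructor returns
  field
    {costs} : List ℕ
    result  : Eval vs (bodies f) v costs
    calls≤  : suc (sum costs) ≤ k

+-time : ∀ {τ₁ τ₂ m₁ m₂} ks₁ {ks₂} → τ₁ ≤ m₁ + bodySize * sum ks₁ → τ₂ ≤ m₂ + bodySize * sum ks₂ →
         τ₁ + τ₂ ≤ (m₁ + m₂) + bodySize * sum (ks₁ ++ ks₂)
+-time {τ₁} {τ₂} {m₁} {m₂} ks₁ {ks₂} p q = begin
  τ₁ + τ₂                                                        ≤⟨ +-mono-≤ p q ⟩
  (m₁ + bodySize * sum ks₁) + (m₂ + bodySize * sum ks₂)
    ≡⟨ rearrange bodySize m₁ m₂ (sum ks₁) (sum ks₂) ⟩
  (m₁ + m₂) + bodySize * (sum ks₁ + sum ks₂)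
    ≡⟨ ≡.cong (λ k → (m₁ + m₂) + bodySize * k) (sum-++ ks₁ ks₂) ⟨
  (m₁ + m₂) + bodySize * sum (ks₁ ++ ks₂)                        ∎
  where
  open ≤-Reasoning
  rearrange : ∀ c a b x y → (a + c * x) + (b + c * y) ≡ (a + b) + c * (x + y)
  rearrange = solve-∀

module _ {n : ℕ} {ρ : Vec Value n} where

  varᴱ : ∀ {x} → Eval ρ (var x) (lookup ρ x) []
  varᴱ = eval (var _) (m≤m+n _ _)

  nilᴱ : Eval ρ nil nil []
  nilᴱ = eval nil (m≤m+n _ _)

  numᴱ : ∀ {m} → Eval ρ (num m) (num m) []
  numᴱ = eval (num _) (m≤m+n _ _)

  infixr 5 _▹ᴱ_ _∷ᴱ_

  _▹ᴱ_ : ∀ {e₁ e₂ v₁ v₂ ks₁ ks₂} → Eval ρ e₁ v₁ ks₁ → Eval ρ e₂ v₂ ks₂ →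
         Eval ρ (e₁ ▹ e₂) (v₁ ▹ v₂) (ks₁ ++ ks₂)
  _▹ᴱ_ {e₁} {ks₁ = ks₁} (eval d₁ t₁) (eval d₂ t₂) = eval (d₁ ▹ d₂) (s≤s (+-time {m₁ = ‖ e₁ ‖} ks₁ t₁ t₂))

  addᴱ : ∀ {e₁ e₂ m₁ m₂ ks₁ ks₂} → Eval ρ e₁ (num m₁) ks₁ → Eval ρ e₂ (num m₂) ks₂ →
         Eval ρ (add e₁ e₂) (num (m₁ + m₂)) (ks₁ ++ ks₂)
  addᴱ {e₁} {ks₁ = ks₁} (eval d₁ t₁) (eval d₂ t₂) = eval (add d₁ d₂) (s≤s (+-time {m₁ = ‖ e₁ ‖} ks₁ t₁ t₂))

  mulᴱ : ∀ {e₁ e₂ m₁ m₂ ks₁ ks₂} → Eval ρ e₁ (num m₁) ks₁ → Eval ρ e₂ (num m₂) ks₂ →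
         Eval ρ (mul e₁ e₂) (num (m₁ * m₂)) (ks₁ ++ ks₂)
  mulᴱ {e₁} {ks₁ = ks₁} (eval d₁ t₁) (eval d₂ t₂) = eval (mul d₁ d₂) (s≤s (+-time {m₁ = ‖ e₁ ‖} ks₁ t₁ t₂))

  match-pairᴱ : ∀ {e e₁ e₂ v₁ v₂ v ks₁ ks₂} → Eval ρ e (v₁ ▹ v₂) ks₁ → Eval (v₁ ∷ v₂ ∷ ρ) e₁ v ks₂ →
                Eval ρ (match e e₁ e₂) v (ks₁ ++ ks₂)
  match-pairᴱ {e} {e₁} {e₂} {ks₁ = ks₁} (eval d₁ t₁) (eval d₂ t₂) =
    eval (match-pair d₁ d₂) (s≤s (+-time {m₁ = ‖ e ‖} ks₁ t₁ (≤-trans t₂ (+-monoˡ-≤ _ (m≤m+n ‖ e₁ ‖ ‖ e₂ ‖)))))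

  match-nilᴱ : ∀ {e e₁ e₂ v ks₁ ks₂} → Eval ρ e nil ks₁ → Eval ρ e₂ v ks₂ →
               Eval ρ (match e e₁ e₂) v (ks₁ ++ ks₂)
  match-nilᴱ {e} {e₁} {e₂} {ks₁ = ks₁} (eval d₁ t₁) (eval d₂ t₂) =
    eval (match-nil d₁ d₂) (s≤s (+-time {m₁ = ‖ e ‖} ks₁ t₁ (≤-trans t₂ (+-monoˡ-≤ _ (m≤n+m ‖ e₂ ‖ ‖ e₁ ‖)))))

  []ᴱ : Evals ρ [] [] []
  []ᴱ = evals [] z≤n

  _∷ᴱ_ : ∀ {k e v ks₁ ks₂} {es : Vec (Expr arities n) k} {vs} → Eval ρ e v ks₁ → Evals ρ es vs ks₂ →
         Evals ρ (e ∷ es) (v ∷ vs) (ks₁ ++ ks₂)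
  _∷ᴱ_ {e = e} {ks₁ = ks₁} (eval d₁ t₁) (evals d₂ t₂) = evals (d₁ ∷ d₂) (+-time {m₁ = ‖ e ‖} ks₁ t₁ t₂)

  -- The nodes of the body cost at most `bodySize`, which is the charge for this call itself; the
  -- calls made inside bring their own charges, and together these are at most `bodySize * k`. The
  -- step of calling is paid by the node `call`.
  callᴱ : ∀ {f es vs v k ks} → Evals ρ es vs ks → Call f vs v k → Eval ρ (call f es) v (ks ++ k ∷ [])
  callᴱ {f} {es} {k = k} {ks} (evals {τ₁} d₁ t₁) (returns {ks′} (eval {τ₂} d₂ t₂) c) =
    eval (call f d₁ d₂) (s≤s (begin
      τ₁ + τ₂                                               ≤⟨ +-time {m₁ = ‖ es ‖*} ks t₁ (begin
        τ₂                                       ≤⟨ t₂ ⟩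
        ‖ bodies f ‖ + bodySize * sum ks′        ≤⟨ +-monoˡ-≤ _ (‖body‖≤ f) ⟩
        bodySize + bodySize * sum ks′            ≡⟨ *-suc bodySize (sum ks′) ⟨
        bodySize * suc (sum ks′)                 ≤⟨ *-monoʳ-≤ bodySize c ⟩
        bodySize * k                             ≡⟨ ≡.cong (bodySize *_) (+-identityʳ k) ⟨
        0 + bodySize * sum (k ∷ [])              ∎) ⟩
      (‖ es ‖* + 0) + bodySize * sum (ks ++ k ∷ [])
        ≡⟨ ≡.cong (_+ bodySize * sum (ks ++ k ∷ [])) (+-identityʳ ‖ es ‖*) ⟩
      ‖ es ‖* + bodySize * sum (ks ++ k ∷ [])               ∎))
    where open ≤-Reasoning

call-≤ : ∀ {f vs v k k′} → k ≤ k′ → Call f vs v k → Call f vs v k′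
call-≤ k≤k′ (returns r c) = returns r (≤-trans c k≤k′)

module _ {f : Fin 14} {vs : Vec Value (arities f)} {v : Value} where

  returns₀ : ∀ {k} → Eval vs (bodies f) v [] → Call f vs v (suc k)
  returns₀ e = returns e (s≤s z≤n)

  -- The cost of a traversal has the form `suc n * suc c`, which computes to `suc (c + n * suc c)`:
  -- this call, the work on one entry, the rest of the list. A branch that stops early leaves a
  -- summand over, absorbed here by `k`.
  returns₁₊ : ∀ {a a′ k} → Eval vs (bodies f) v (a ∷ []) → a ≤ a′ → Call f vs v (suc (a′ + k))
  returns₁₊ {a} e a≤ = returns e (s≤s (+-mono-≤ a≤ z≤n))

  returns₂₊ : ∀ {a a′ b b′ k} → Eval vs (bodies f) v (a ∷ b ∷ []) → a ≤ a′ → b ≤ b′ → Call f vs v (suc (a′ + b′ + k))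
  returns₂₊ {a′ = a′} {b′ = b′} {k} e a≤ b≤ = returns e (s≤s (≤-trans
    (+-mono-≤ a≤ (+-mono-≤ b≤ z≤n)) (≤-reflexive (≡.sym (+-assoc a′ b′ k)))))

  returns₁ : ∀ {a a′} → Eval vs (bodies f) v (a ∷ []) → a ≤ a′ → Call f vs v (suc a′)
  returns₁ {a} e a≤ = returns e (s≤s (≤-trans (≤-reflexive (+-identityʳ a)) a≤))

  returns₂ : ∀ {a a′ b b′} → Eval vs (bodies f) v (a ∷ b ∷ []) → a ≤ a′ → b ≤ b′ → Call f vs v (suc (a′ + b′))
  returns₂ {b = b} e a≤ b≤ = returns e (s≤s (+-mono-≤ a≤ (≤-trans (≤-reflexive (+-identityʳ b)) b≤)))

  returns₃ : ∀ {a a′ b b′ c c′} → Eval vs (bodies f) v (a ∷ b ∷ c ∷ []) → a ≤ a′ → b ≤ b′ → c ≤ c′ →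
             Call f vs v (suc (a′ + b′ + c′))
  returns₃ {a′ = a′} {b′ = b′} {c} {c′} e a≤ b≤ c≤ = returns e (s≤s (≤-trans
    (+-mono-≤ a≤ (+-mono-≤ b≤ (≤-trans (≤-reflexive (+-identityʳ c)) c≤))) (≤-reflexive (≡.sym (+-assoc a′ b′ c′)))))

  returns₄ : ∀ {a a′ b b′ c c′ d d′} → Eval vs (bodies f) v (a ∷ b ∷ c ∷ d ∷ []) → a ≤ a′ → b ≤ b′ → c ≤ c′ → d ≤ d′ →
             Call f vs v (suc (a′ + b′ + c′ + d′))
  returns₄ {a} {a′} {b} {b′} {c} {c′} {d} {d′} e a≤ b≤ c≤ d≤ = returns e (s≤s (begin
    a + (b + (c + (d + 0)))   ≡⟨ rearrange a b c d ⟩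
    a + b + c + d             ≤⟨ +-mono-≤ (+-mono-≤ (+-mono-≤ a≤ b≤) c≤) d≤ ⟩
    a′ + b′ + c′ + d′         ∎))
    where
    open ≤-Reasoning
    rearrange : ∀ a b c d → a + (b + (c + (d + 0))) ≡ a + b + c + d
    rearrange = solve-∀

∣_∣ᵛ : Value → ℕ
∣ nil ∣ᵛ    = 1
∣ v ▹ w ∣ᵛ  = suc (∣ v ∣ᵛ + ∣ w ∣ᵛ)
∣ num _ ∣ᵛ  = 1

encodeBool : Bool → Value
encodeBool tt = nil ▹ nil
encodeBool ff = nil

encodeMaybe : ∀ {A : Set} → (A → Value) → Maybe A → Value
encodeMaybe enc nothing  = nil
encodeMaybe enc (just a) = enc a ▹ nil

-- M bounds the encoded size of the terms and n the length of the lists.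
module Costs (M n : ℕ) where

  lookupCost subArgsCost productCost findCost totalCost readyCost subRulesCost closeCost tableCost : ℕ
  lookupCost   = suc n * suc M
  findCost     = suc n * suc lookupCost
  subArgsCost  = suc M * suc (suc M)
  subRulesCost = suc n * suc (subArgsCost + suc M)
  productCost  = suc M * suc lookupCost
  totalCost    = suc n * suc (M + productCost)
  readyCost    = suc n * suc (lookupCost + totalCost)
  closeCost    = suc n * suc (findCost + subRulesCost + suc M)
  tableCost    = suc n * suc readyCost

-- The functions that the procedures compute

Rules Table : Signature → Set
Rules S = List (Term S × Term S)
Table S = List (Term S × ℕ)

module _ {S : Signature} where

  mutual
    infix 4 _≟_ _≟ˢ_

    _≟_ : (t u : Term S) → Dec (t ≡ u)
    app f ts ≟ app g us with f Fin.≟ g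
    ... | no f≢g   = no λ { refl → f≢g refl }
    ... | yes refl = map′ (≡.cong (app f)) (λ { refl → refl }) (ts ≟ˢ us)

    _≟ˢ_ : ∀ {n} (ts us : Vec (Term S) n) → Dec (ts ≡ us)
    []       ≟ˢ []       = yes refl
    (t ∷ ts) ≟ˢ (u ∷ us) = map′ (λ { (refl , refl) → refl }) (λ { refl → refl , refl }) ((t ≟ u) ×-dec (ts ≟ˢ us))

  size : Term S → ℕ
  size t = ∣ encodeTerm t ∣ᵛ

  encodeAssoc : ∀ {A : Set} → (A → Value) → List (Term S × A) → Value
  encodeAssoc enc []             = nil
  encodeAssoc enc ((k , a) ∷ xs) = (encodeTerm k ▹ enc a) ▹ encodeAssoc enc xs

  encodeRules : Rules S → Value
  encodeRules = encodeAssoc encodeTerm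

  encodeTable : Table S → Value
  encodeTable = encodeAssoc num

  assoc : ∀ {A : Set} → Term S → List (Term S × A) → Maybe A
  assoc k []             = nothing
  assoc k ((l , a) ∷ xs) = if does (k ≟ l) then just a else assoc k xs

  -- The deleted rule is `l → a`; the rule `l → b` that is kept is the first later one for `l`. The
  -- states `a` and `b` may coincide: the renaming is then the identity, but a rule still
  -- disappears, and repeated rules of common subterms are removed in this way.
  data Duplicate (a b : Term S) : Rules S → Rules S → Set where
    here  : ∀ {l Δ} → assoc l Δ ≡ just b → Duplicate a b ((l , a) ∷ Δ) Δ
    there : ∀ {l r Δ Δ′} → Duplicate a b Δ Δ′ → Duplicate a b ((l , r) ∷ Δ) ((l , r) ∷ Δ′)

  data Deterministic : Rules S → Set where
    []  : Deterministic []
    _∷_ : ∀ {l r Δ} → assoc l Δ ≡ nothing → Deterministic Δ → Deterministic ((l , r) ∷ Δ)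

  sub : (a b x : Term S) → Term S
  sub a b x = if does (a ≟ x) then b else x

  -- A left-hand side is a symbol applied to states and not itself a state, so its root is left
  -- alone even if the same term also names a state.
  mapArgs : (Term S → Term S) → Term S → Term S
  mapArgs σ (app f ts) = app f (Vec.map σ ts)

  rename : (Term S → Term S) → Rules S → Rules S
  rename σ = map (Product.map (mapArgs σ) σ)

  product : ∀ {n} → Table S → Vec (Term S) n → Maybe ℕ
  product D []       = just 1
  product D (t ∷ ts) = zipWith _*_ (assoc t D) (product D ts)

  total : Table S → Term S → Rules S → Maybe ℕ
  total D c []                  = just 0
  total D c ((app f ts , r) ∷ Δ) =
    if does (c ≟ r) then zipWith _+_ (product D ts) (total D c Δ) else total D c Δ

  mutual
    diag : Term S → Rules S
    diag (app f ts) = (app f ts , app f ts) ∷ diags ts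

    diags : ∀ {n} → Vec (Term S) n → Rules S
    diags []       = []
    diags (t ∷ ts) = diag t ++ diags ts

  initial : Equations S → Rules S
  initial []            = []
  initial ((p , q) ∷ Γ) = (p , q) ∷ (diag p ++ diag q ++ initial Γ)

  -- Calls of the procedures: results and costs

  private
    double-suc : ∀ a → suc (2 * a) ≤ 2 * suc a
    double-suc a = ≤-trans (n≤1+n _) (≤-reflexive (≡.sym (*-suc 2 a)))

    -- One procedure compares symbols, terms and argument lists, because it compares codes as binary
    -- trees. Each call uses up a node of the first tree, so the number of calls is at most the size
    -- of that tree.
    eqSymbol-call : ∀ {k} (f g : Fin k) →
      Call eqᶠ (encodeSymbol f ∷ encodeSymbol g ∷ []) (encodeBool (does (f Fin.≟ g))) ∣ encodeSymbol f ∣ᵛ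
    eqSymbol-call zero    zero    = returns₀ (match-nilᴱ varᴱ (match-nilᴱ varᴱ (nilᴱ ▹ᴱ nilᴱ)))
    eqSymbol-call zero    (suc g) = returns₀ (match-nilᴱ varᴱ (match-pairᴱ varᴱ nilᴱ))
    eqSymbol-call (suc f) zero    = returns₀ (match-pairᴱ varᴱ (match-nilᴱ varᴱ nilᴱ))
    eqSymbol-call (suc f) (suc g) = returns₂
      (match-pairᴱ varᴱ (match-pairᴱ varᴱ
        -- Both heads are `nil`, which is the code of `zero`.
        (match-pairᴱ (callᴱ (varᴱ ∷ᴱ varᴱ ∷ᴱ []ᴱ) (eqSymbol-call {1} zero zero))
          (callᴱ (varᴱ ∷ᴱ varᴱ ∷ᴱ []ᴱ) (eqSymbol-call f g)))))
      ≤-refl ≤-refl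

  mutual
    eq-call : ∀ t u → Call eqᶠ (encodeTerm t ∷ encodeTerm u ∷ []) (encodeBool (does (t ≟ u))) (size t)
    eq-call (app f ts) (app g us) with f Fin.≟ g | eqSymbol-call f g
    ... | no _     | eq-f = returns₁
      (match-pairᴱ varᴱ (match-pairᴱ varᴱ
        (match-nilᴱ (callᴱ (varᴱ ∷ᴱ varᴱ ∷ᴱ []ᴱ) eq-f) nilᴱ)))
      (m≤m+n _ _)
    ... | yes refl | eq-f = returns₂
      (match-pairᴱ varᴱ (match-pairᴱ varᴱ
        (match-pairᴱ (callᴱ (varᴱ ∷ᴱ varᴱ ∷ᴱ []ᴱ) eq-f)
          (callᴱ (varᴱ ∷ᴱ varᴱ ∷ᴱ []ᴱ) (eqs-call ts us)))))
      ≤-refl ≤-refl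

    eqs-call : ∀ {n} (ts us : Vec (Term S) n) →
      Call eqᶠ (encodeTerms ts ∷ encodeTerms us ∷ []) (encodeBool (does (ts ≟ˢ us))) ∣ encodeTerms ts ∣ᵛ
    eqs-call []       []       = returns₀ (match-nilᴱ varᴱ (match-nilᴱ varᴱ (nilᴱ ▹ᴱ nilᴱ)))
    eqs-call (t ∷ ts) (u ∷ us) with t ≟ u | eq-call t u
    ... | no _  | eq-t = returns₁
      (match-pairᴱ varᴱ (match-pairᴱ varᴱ
        (match-nilᴱ (callᴱ (varᴱ ∷ᴱ varᴱ ∷ᴱ []ᴱ) eq-t) nilᴱ)))
      (m≤m+n _ _)
    ... | yes _ | eq-t = returns₂
      (match-pairᴱ varᴱ (match-pairᴱ varᴱ
        (match-pairᴱ (callᴱ (varᴱ ∷ᴱ varᴱ ∷ᴱ []ᴱ) eq-t)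
          (callᴱ (varᴱ ∷ᴱ varᴱ ∷ᴱ []ᴱ) (eqs-call ts us)))))
      ≤-refl ≤-refl

  length≤∣encodeTerms∣ : ∀ {n} (ts : Vec (Term S) n) → n ≤ ∣ encodeTerms ts ∣ᵛ
  length≤∣encodeTerms∣ []       = z≤n
  length≤∣encodeTerms∣ (t ∷ ts) = s≤s (≤-trans (length≤∣encodeTerms∣ ts) (m≤n+m _ _))

  args≤size : ∀ f (ts : Vec (Term S) (arity S f)) → ∣ encodeTerms ts ∣ᵛ ≤ size (app f ts)
  args≤size f ts = ≤-trans (m≤n+m _ ∣ encodeSymbol f ∣ᵛ) (n≤1+n _)

  module _ (M n : ℕ) where

    open Costs M n

    Small : Rules S → Set
    Small = All λ (l , r) → size l ≤ M × size r ≤ M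

    arity≤ : ∀ f (ts : Vec (Term S) (arity S f)) → size (app f ts) ≤ M → arity S f ≤ M
    arity≤ f ts ≤M = ≤-trans (length≤∣encodeTerms∣ ts) (≤-trans (args≤size f ts) ≤M)

    -- Rules and tables share this procedure, hence the arbitrary `enc`. Only keys are compared, and
    -- a comparison costs at most the size of `k`, whatever the other key is.
    assoc-call : ∀ {A : Set} (enc : A → Value) k xs → size k ≤ M → length xs ≤ n →
      Call lookupᶠ (encodeTerm k ∷ encodeAssoc enc xs ∷ []) (encodeMaybe enc (assoc k xs)) lookupCost
    assoc-call enc k xs k≤ xs≤ = call-≤ (*-monoˡ-≤ (suc M) (s≤s xs≤)) (go xs)
      where
      go : ∀ xs → Call lookupᶠ (encodeTerm k ∷ encodeAssoc enc xs ∷ [])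
                       (encodeMaybe enc (assoc k xs)) (suc (length xs) * suc M)
      go []             = returns₀ (match-nilᴱ varᴱ nilᴱ)
      go ((l , a) ∷ xs) with k ≟ l | eq-call k l
      ... | yes _ | eq-k = returns₁₊
        (match-pairᴱ varᴱ (match-pairᴱ varᴱ
          (match-pairᴱ (callᴱ (varᴱ ∷ᴱ varᴱ ∷ᴱ []ᴱ) eq-k) (varᴱ ▹ᴱ nilᴱ))))
        k≤
      ... | no _  | eq-k = returns₂
        (match-pairᴱ varᴱ (match-pairᴱ varᴱ
          (match-nilᴱ (callᴱ (varᴱ ∷ᴱ varᴱ ∷ᴱ []ᴱ) eq-k)
            (callᴱ (varᴱ ∷ᴱ varᴱ ∷ᴱ []ᴱ) (go xs)))))
        k≤ ≤-refl

    -- The outcome is described by its property and not by a function: correctness does not depend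
    -- on which duplicate is found.
    FindResult : Rules S → ℕ → Set
    FindResult Δ k =
      (∃[ a ] ∃[ b ] ∃[ Δ′ ] Duplicate a b Δ Δ′ ×
         Call findᶠ (encodeRules Δ ∷ []) ((encodeTerm a ▹ encodeTerm b) ▹ encodeRules Δ′) k)
      ⊎ (Deterministic Δ × Call findᶠ (encodeRules Δ ∷ []) nil k)

    find-call : ∀ Δ → Small Δ → length Δ ≤ n → FindResult Δ findCost
    find-call Δ small Δ≤ = widen (*-monoˡ-≤ (suc lookupCost) (s≤s Δ≤)) (go Δ small Δ≤)
      where
      widen : ∀ {Δ k k′} → k ≤ k′ → FindResult Δ k → FindResult Δ k′
      widen k≤ (inj₁ (a , b , Δ′ , d , c)) = inj₁ (a , b , Δ′ , d , call-≤ k≤ c)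
      widen k≤ (inj₂ (d , c))              = inj₂ (d , call-≤ k≤ c)

      go : ∀ Δ → Small Δ → length Δ ≤ n → FindResult Δ (suc (length Δ) * suc lookupCost)
      go []            _               _  = inj₂ ([] , returns₀ (match-nilᴱ varᴱ nilᴱ))
      go ((l , r) ∷ Δ) ((l≤ , _) ∷ sm) Δ<
        with assoc l Δ in eq | assoc-call encodeTerm l Δ l≤ (<⇒≤ Δ<)
      ... | just b  | lk = inj₁ (r , b , Δ , here eq , returns₁₊
        (match-pairᴱ varᴱ (match-pairᴱ varᴱ
          (match-pairᴱ (callᴱ (varᴱ ∷ᴱ varᴱ ∷ᴱ []ᴱ) lk)
            ((varᴱ ▹ᴱ varᴱ) ▹ᴱ varᴱ))))
        ≤-refl)
      ... | nothing | lk with go Δ sm (<⇒≤ Δ<)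
      ...   | inj₁ (a , b , Δ′ , d , c) = inj₁ (a , b , (l , r) ∷ Δ′ , there d , returns₂
        (match-pairᴱ varᴱ (match-pairᴱ varᴱ
          (match-nilᴱ (callᴱ (varᴱ ∷ᴱ varᴱ ∷ᴱ []ᴱ) lk)
            (match-pairᴱ (callᴱ (varᴱ ∷ᴱ []ᴱ) c) (varᴱ ▹ᴱ (varᴱ ▹ᴱ varᴱ))))))
        ≤-refl ≤-refl)
      ...   | inj₂ (d , c) = inj₂ (eq ∷ d , returns₂
        (match-pairᴱ varᴱ (match-pairᴱ varᴱ
          (match-nilᴱ (callᴱ (varᴱ ∷ᴱ varᴱ ∷ᴱ []ᴱ) lk)
            (match-nilᴱ (callᴱ (varᴱ ∷ᴱ []ᴱ) c) nilᴱ))))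
        ≤-refl ≤-refl)

    module _ (a b : Term S) (a≤ : size a ≤ M) where

      sub-call : ∀ x →
        Call subᶠ (encodeTerm a ∷ encodeTerm b ∷ encodeTerm x ∷ []) (encodeTerm (sub a b x)) (suc M)
      sub-call x with a ≟ x | eq-call a x
      ... | yes _ | eq-a = returns₁ (match-pairᴱ (callᴱ (varᴱ ∷ᴱ varᴱ ∷ᴱ []ᴱ) eq-a) varᴱ) a≤
      ... | no _  | eq-a = returns₁ (match-nilᴱ (callᴱ (varᴱ ∷ᴱ varᴱ ∷ᴱ []ᴱ) eq-a) varᴱ) a≤

      subArgs-call : ∀ {k} (ts : Vec (Term S) k) →
        Call subArgsᶠ (encodeTerm a ∷ encodeTerm b ∷ encodeTerms ts ∷ [])
          (encodeTerms (Vec.map (sub a b) ts)) (suc k * suc (suc M))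
      subArgs-call []       = returns₀ (match-nilᴱ varᴱ nilᴱ)
      subArgs-call (t ∷ ts) = returns₂
        (match-pairᴱ varᴱ
          (callᴱ (varᴱ ∷ᴱ varᴱ ∷ᴱ varᴱ ∷ᴱ []ᴱ) (sub-call t)
          ▹ᴱ callᴱ (varᴱ ∷ᴱ varᴱ ∷ᴱ varᴱ ∷ᴱ []ᴱ) (subArgs-call ts)))
        ≤-refl ≤-refl

      subRules-call : ∀ Δ → Small Δ → length Δ ≤ n →
        Call subRulesᶠ (encodeTerm a ∷ encodeTerm b ∷ encodeRules Δ ∷ [])
          (encodeRules (rename (sub a b) Δ)) subRulesCost
      subRules-call Δ small Δ≤ = call-≤ (*-monoˡ-≤ (suc (subArgsCost + suc M)) (s≤s Δ≤)) (go Δ small)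
        where
        go : ∀ Δ → Small Δ →
          Call subRulesᶠ (encodeTerm a ∷ encodeTerm b ∷ encodeRules Δ ∷ [])
            (encodeRules (rename (sub a b) Δ)) (suc (length Δ) * suc (subArgsCost + suc M))
        go []                    _               = returns₀ (match-nilᴱ varᴱ nilᴱ)
        go ((app f ts , r) ∷ Δ) ((l≤ , _) ∷ sm) = returns₃
          (match-pairᴱ varᴱ (match-pairᴱ varᴱ (match-pairᴱ varᴱ
            (((varᴱ ▹ᴱ callᴱ (varᴱ ∷ᴱ varᴱ ∷ᴱ varᴱ ∷ᴱ []ᴱ) (subArgs-call ts))
              ▹ᴱ callᴱ (varᴱ ∷ᴱ varᴱ ∷ᴱ varᴱ ∷ᴱ []ᴱ) (sub-call r))
             ▹ᴱ callᴱ (varᴱ ∷ᴱ varᴱ ∷ᴱ varᴱ ∷ᴱ []ᴱ) (go Δ sm)))))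
          (*-monoˡ-≤ (suc (suc M)) (s≤s (arity≤ f ts l≤)))
            ≤-refl ≤-refl

    module _ (D : Table S) (D≤ : length D ≤ n) where

      product-call : ∀ {k} (ts : Vec (Term S) k) → ∣ encodeTerms ts ∣ᵛ ≤ M →
        Call productᶠ (encodeTable D ∷ encodeTerms ts ∷ []) (encodeMaybe num (product D ts)) (suc k * suc lookupCost)
      product-call []       _   = returns₀ (match-nilᴱ varᴱ (numᴱ ▹ᴱ nilᴱ))
      product-call (t ∷ ts) ts≤
        with assoc t D | assoc-call num t D (≤-trans (m≤m+n _ _) (<⇒≤ ts≤)) D≤
      ... | nothing | lk = returns₁₊
        (match-pairᴱ varᴱ (match-nilᴱ (callᴱ (varᴱ ∷ᴱ varᴱ ∷ᴱ []ᴱ) lk) nilᴱ))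
        ≤-refl
      ... | just _  | lk with product D ts | product-call ts (≤-trans (m≤n+m _ (size t)) (<⇒≤ ts≤))
      ...   | nothing | pr = returns₂
        (match-pairᴱ varᴱ (match-pairᴱ (callᴱ (varᴱ ∷ᴱ varᴱ ∷ᴱ []ᴱ) lk)
          (match-nilᴱ (callᴱ (varᴱ ∷ᴱ varᴱ ∷ᴱ []ᴱ) pr) nilᴱ)))
        ≤-refl ≤-refl
      ...   | just _  | pr = returns₂
        (match-pairᴱ varᴱ (match-pairᴱ (callᴱ (varᴱ ∷ᴱ varᴱ ∷ᴱ []ᴱ) lk)
          (match-pairᴱ (callᴱ (varᴱ ∷ᴱ varᴱ ∷ᴱ []ᴱ) pr) (mulᴱ varᴱ varᴱ ▹ᴱ nilᴱ))))
        ≤-refl ≤-refl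

      total-call : ∀ c Δ → size c ≤ M → Small Δ → length Δ ≤ n →
        Call totalᶠ (encodeTable D ∷ encodeTerm c ∷ encodeRules Δ ∷ []) (encodeMaybe num (total D c Δ)) totalCost
      total-call c Δ c≤ small Δ≤ = call-≤ (*-monoˡ-≤ (suc (M + productCost)) (s≤s Δ≤)) (go Δ small)
        where
        go : ∀ Δ → Small Δ →
          Call totalᶠ (encodeTable D ∷ encodeTerm c ∷ encodeRules Δ ∷ []) (encodeMaybe num (total D c Δ))
            (suc (length Δ) * suc (M + productCost))
        go []                   _               = returns₀ (match-nilᴱ varᴱ (numᴱ ▹ᴱ nilᴱ))
        go ((app f ts , r) ∷ Δ) ((l≤ , _) ∷ sm) with c ≟ r | eq-call c r
        ... | no _  | eq-c = returns₂
          (match-pairᴱ varᴱ (match-pairᴱ varᴱ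
            (match-nilᴱ (callᴱ (varᴱ ∷ᴱ varᴱ ∷ᴱ []ᴱ) eq-c)
              (callᴱ (varᴱ ∷ᴱ varᴱ ∷ᴱ varᴱ ∷ᴱ []ᴱ) (go Δ sm)))))
          (≤-trans c≤ (m≤m+n _ _)) ≤-refl
        ... | yes _ | eq-c with product D ts | product-call ts (≤-trans (args≤size f ts) l≤)
        ...   | nothing | pr = returns₂₊
          (match-pairᴱ varᴱ (match-pairᴱ varᴱ
            (match-pairᴱ (callᴱ (varᴱ ∷ᴱ varᴱ ∷ᴱ []ᴱ) eq-c) (match-pairᴱ varᴱ
              (match-nilᴱ (callᴱ (varᴱ ∷ᴱ varᴱ ∷ᴱ []ᴱ) pr) nilᴱ)))))
          c≤ (*-monoˡ-≤ (suc lookupCost) (s≤s (arity≤ f ts l≤)))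
        ...   | just _  | pr with total D c Δ | go Δ sm
        ...     | nothing | tl = returns₃
          (match-pairᴱ varᴱ (match-pairᴱ varᴱ
            (match-pairᴱ (callᴱ (varᴱ ∷ᴱ varᴱ ∷ᴱ []ᴱ) eq-c) (match-pairᴱ varᴱ
              (match-pairᴱ (callᴱ (varᴱ ∷ᴱ varᴱ ∷ᴱ []ᴱ) pr)
                (match-nilᴱ (callᴱ (varᴱ ∷ᴱ varᴱ ∷ᴱ varᴱ ∷ᴱ []ᴱ) tl) nilᴱ))))))
          c≤ (*-monoˡ-≤ (suc lookupCost) (s≤s (arity≤ f ts l≤))) ≤-refl
        ...     | just _  | tl = returns₃
          (match-pairᴱ varᴱ (match-pairᴱ varᴱ
            (match-pairᴱ (callᴱ (varᴱ ∷ᴱ varᴱ ∷ᴱ []ᴱ) eq-c) (match-pairᴱ varᴱ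
              (match-pairᴱ (callᴱ (varᴱ ∷ᴱ varᴱ ∷ᴱ []ᴱ) pr)
                (match-pairᴱ (callᴱ (varᴱ ∷ᴱ varᴱ ∷ᴱ varᴱ ∷ᴱ []ᴱ) tl) (addᴱ varᴱ varᴱ ▹ᴱ nilᴱ)))))))
          c≤ (*-monoˡ-≤ (suc lookupCost) (s≤s (arity≤ f ts l≤))) ≤-refl

      -- The search runs over the remaining rules `Δ′`, while `Δ` stays whole, since a total needs
      -- all the rules of a state.
      ReadyResult : Rules S → Rules S → ℕ → Set
      ReadyResult Δ Δ′ k =
        (∃[ l ] ∃[ r ] ∃[ m ] (l , r) ∈ Δ′ × assoc r D ≡ nothing × total D r Δ ≡ just m ×
          Call readyᶠ (encodeTable D ∷ encodeRules Δ ∷ encodeRules Δ′ ∷ []) ((encodeTerm r ▹ num m) ▹ nil) k)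
        ⊎ ((∀ {l r} → (l , r) ∈ Δ′ → assoc r D ≡ nothing → total D r Δ ≡ nothing) ×
          Call readyᶠ (encodeTable D ∷ encodeRules Δ ∷ encodeRules Δ′ ∷ []) nil k)

      ready-call : ∀ Δ → Small Δ → length Δ ≤ n → ReadyResult Δ Δ readyCost
      ready-call Δ small Δ≤ = widen (*-monoˡ-≤ (suc (lookupCost + totalCost)) (s≤s Δ≤)) (go Δ small)
        where
        widen : ∀ {Δ′ k k′} → k ≤ k′ → ReadyResult Δ Δ′ k → ReadyResult Δ Δ′ k′
        widen k≤ (inj₁ (l , r , m , r∈ , u , e , c)) = inj₁ (l , r , m , r∈ , u , e , call-≤ k≤ c)
        widen k≤ (inj₂ (none , c))                   = inj₂ (none , call-≤ k≤ c)

        go : ∀ Δ′ → Small Δ′ → ReadyResult Δ Δ′ (suc (length Δ′) * suc (lookupCost + totalCost))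
        go []             _                = inj₂ ((λ ()) , returns₀ (match-nilᴱ varᴱ nilᴱ))
        go ((l , r) ∷ Δ′) ((_ , r≤) ∷ sm) with assoc r D in known | assoc-call num r D r≤ D≤
        ... | just _  | lk with go Δ′ sm
        ...   | inj₁ (l′ , r′ , m , r∈ , u , e , c) = inj₁ (l′ , r′ , m , there r∈ , u , e , returns₂
          (match-pairᴱ varᴱ (match-pairᴱ varᴱ
            (match-pairᴱ (callᴱ (varᴱ ∷ᴱ varᴱ ∷ᴱ []ᴱ) lk)
              (callᴱ (varᴱ ∷ᴱ varᴱ ∷ᴱ varᴱ ∷ᴱ []ᴱ) c))))
          (m≤m+n _ _) ≤-refl)
        ...   | inj₂ (none , c) = inj₂
          ( (λ { (here refl) u → contradiction (≡.trans (≡.sym known) u) λ () ; (there r∈) u → none r∈ u })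
          , returns₂
            (match-pairᴱ varᴱ (match-pairᴱ varᴱ
              (match-pairᴱ (callᴱ (varᴱ ∷ᴱ varᴱ ∷ᴱ []ᴱ) lk)
                (callᴱ (varᴱ ∷ᴱ varᴱ ∷ᴱ varᴱ ∷ᴱ []ᴱ) c))))
            (m≤m+n _ _) ≤-refl)
        go ((l , r) ∷ Δ′) ((_ , r≤) ∷ sm) | nothing | lk
          with total D r Δ in sum≡ | total-call r Δ r≤ small Δ≤
        ...   | just m  | tl = inj₁ (l , r , m , here refl , known , sum≡ , returns₂₊
          (match-pairᴱ varᴱ (match-pairᴱ varᴱ
            (match-nilᴱ (callᴱ (varᴱ ∷ᴱ varᴱ ∷ᴱ []ᴱ) lk)
              (match-pairᴱ (callᴱ (varᴱ ∷ᴱ varᴱ ∷ᴱ varᴱ ∷ᴱ []ᴱ) tl) ((varᴱ ▹ᴱ varᴱ) ▹ᴱ nilᴱ)))))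
          ≤-refl ≤-refl)
        ...   | nothing | tl with go Δ′ sm
        ...     | inj₁ (l′ , r′ , m , r∈ , u , e , c) = inj₁ (l′ , r′ , m , there r∈ , u , e , returns₃
          (match-pairᴱ varᴱ (match-pairᴱ varᴱ
            (match-nilᴱ (callᴱ (varᴱ ∷ᴱ varᴱ ∷ᴱ []ᴱ) lk)
              (match-nilᴱ (callᴱ (varᴱ ∷ᴱ varᴱ ∷ᴱ varᴱ ∷ᴱ []ᴱ) tl)
                (callᴱ (varᴱ ∷ᴱ varᴱ ∷ᴱ varᴱ ∷ᴱ []ᴱ) c)))))
          ≤-refl ≤-refl ≤-refl)
        ...     | inj₂ (none , c) = inj₂
          ( (λ { (here refl) _ → sum≡ ; (there r∈) u → none r∈ u })
          , returns₃
            (match-pairᴱ varᴱ (match-pairᴱ varᴱ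
              (match-nilᴱ (callᴱ (varᴱ ∷ᴱ varᴱ ∷ᴱ []ᴱ) lk)
                (match-nilᴱ (callᴱ (varᴱ ∷ᴱ varᴱ ∷ᴱ varᴱ ∷ᴱ []ᴱ) tl)
                  (callᴱ (varᴱ ∷ᴱ varᴱ ∷ᴱ varᴱ ∷ᴱ []ᴱ) c)))))
            ≤-refl ≤-refl ≤-refl)

  mutual
    -- The second argument is an accumulator to which the rules are prepended; no lists have to be
    -- concatenated, and the number of calls stays linear in the code of `t`.
    diag-call : ∀ t Δ → Call diagᶠ (encodeTerm t ∷ encodeRules Δ ∷ []) (encodeRules (diag t ++ Δ)) (2 * size t)
    diag-call (app f ts) Δ = call-≤
      (≤-trans (s≤s (*-monoʳ-≤ 2 (m≤n+m ∣ encodeTerms ts ∣ᵛ ∣ encodeSymbol f ∣ᵛ)))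
        (double-suc (∣ encodeSymbol f ∣ᵛ + ∣ encodeTerms ts ∣ᵛ)))
      (returns₁ (match-pairᴱ varᴱ ((varᴱ ▹ᴱ varᴱ) ▹ᴱ callᴱ (varᴱ ∷ᴱ varᴱ ∷ᴱ []ᴱ) (diags-call ts Δ))) ≤-refl)

    diags-call : ∀ {n} (ts : Vec (Term S) n) Δ →
      Call diagsᶠ (encodeTerms ts ∷ encodeRules Δ ∷ []) (encodeRules (diags ts ++ Δ)) (2 * ∣ encodeTerms ts ∣ᵛ)
    diags-call []       Δ = returns₀ (match-nilᴱ varᴱ varᴱ)
    diags-call (t ∷ ts) Δ rewrite ++-assoc (diag t) (diags ts) Δ = call-≤
      (≤-trans (≤-reflexive (≡.cong suc (distrib (size t) ∣ encodeTerms ts ∣ᵛ)))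
        (double-suc (size t + ∣ encodeTerms ts ∣ᵛ)))
      (returns₂ (match-pairᴱ varᴱ
        (callᴱ (varᴱ ∷ᴱ callᴱ (varᴱ ∷ᴱ varᴱ ∷ᴱ []ᴱ) (diags-call ts Δ) ∷ᴱ []ᴱ) (diag-call t (diags ts ++ Δ))))
        ≤-refl ≤-refl)
      where
      distrib : ∀ a b → 2 * b + 2 * a ≡ 2 * (a + b)
      distrib = solve-∀

  initial-call : ∀ Γ Δ →
    Call initialᶠ (encodeEquations Γ ∷ encodeRules Δ ∷ []) (encodeRules (initial Γ ++ Δ)) (2 * ∣ encodeEquations Γ ∣ᵛ)
  initial-call []            Δ = returns₀ (match-nilᴱ varᴱ varᴱ)
  initial-call ((p , q) ∷ Γ) Δ
    rewrite ++-assoc (diag p) (diag q ++ initial Γ) Δ | ++-assoc (diag q) (initial Γ) Δ = call-≤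
      (≤-trans (≤-reflexive (≡.cong suc (distrib (size p) (size q) ∣ encodeEquations Γ ∣ᵛ)))
        (≤-trans (double-suc (size p + size q + ∣ encodeEquations Γ ∣ᵛ))
          (*-monoʳ-≤ 2 (n≤1+n (suc (size p + size q + ∣ encodeEquations Γ ∣ᵛ))))))
      (returns₃ (match-pairᴱ varᴱ (match-pairᴱ varᴱ ((varᴱ ▹ᴱ varᴱ)
        ▹ᴱ callᴱ (varᴱ ∷ᴱ callᴱ (varᴱ ∷ᴱ callᴱ (varᴱ ∷ᴱ varᴱ ∷ᴱ []ᴱ) (initial-call Γ Δ) ∷ᴱ []ᴱ)
            (diag-call q _) ∷ᴱ []ᴱ) (diag-call p _))))
        ≤-refl ≤-refl ≤-refl)
    where
    distrib : ∀ a b c → 2 * c + 2 * b + 2 * a ≡ 2 * (a + b + c)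
    distrib = solve-∀

-- Enumerations

record Enumeration {A : Set} (Q : A → Set) (m : ℕ) : Set where
  field
    elements : List A
    unique   : Unique elements
    sound    : ∀ {x} → x ∈ elements → Q x
    complete : ∀ {x} → Q x → x ∈ elements
    length≡  : length elements ≡ m

open Enumeration

Enumeration-⇔ : ∀ {A : Set} {Q R : A → Set} {m} → (∀ {x} → Q x → R x) → (∀ {x} → R x → Q x) →
                Enumeration Q m → Enumeration R m
Enumeration-⇔ Q⇒R R⇒Q E = record
  { elements = elements E
  ; unique   = unique E
  ; sound    = Q⇒R ∘ sound E
  ; complete = complete E ∘ R⇒Q
  ; length≡  = length≡ E
  }

length-cartesianProductWith : ∀ {A B C : Set} (f : A → B → C) xs ys →
  length (cartesianProductWith f xs ys) ≡ length xs * length ys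
length-cartesianProductWith f []       ys = refl
length-cartesianProductWith f (x ∷ xs) ys = ≡.trans (length-++ (map (f x) ys))
  (≡.cong₂ _+_ (length-map (f x) ys) (length-cartesianProductWith f xs ys))

lookup-injective : ∀ {A : Set} {xs : List A} → Unique xs → ∀ {i j} →
                   Data.List.lookup xs i ≡ Data.List.lookup xs j → i ≡ j
lookup-injective (x∉ ∷ u) {zero}  {zero}  eq = refl
lookup-injective (x∉ ∷ u) {zero}  {suc j} eq = contradiction eq (All.lookup x∉ (∈-lookup j))
lookup-injective (x∉ ∷ u) {suc i} {zero}  eq = contradiction (≡.sym eq) (All.lookup x∉ (∈-lookup i))
lookup-injective (x∉ ∷ u) {suc i} {suc j} eq = ≡.cong suc (lookup-injective u eq)

zipWith-just⁻ : ∀ {A B C : Set} (f : A → B → C) ma mb {c} → zipWith f ma mb ≡ just c →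
                ∃[ a ] ∃[ b ] ma ≡ just a × mb ≡ just b × f a b ≡ c
zipWith-just⁻ f (just a) (just b) refl = a , b , refl , refl , refl

zipWith-nothing⁻ : ∀ {A B C : Set} (f : A → B → C) ma mb → zipWith f ma mb ≡ nothing →
                   ma ≡ nothing ⊎ mb ≡ nothing
zipWith-nothing⁻ f nothing  mb      _ = inj₁ refl
zipWith-nothing⁻ f (just a) nothing _ = inj₂ refl

-- Renamings, lookup and duplicate rules

module _ {S : Signature} where

  app-injective : ∀ {f} {ts us : Vec (Term S) (arity S f)} → app {S} f ts ≡ app f us → ts ≡ us
  app-injective refl = refl

  mapArgs-id : ∀ t → mapArgs {S} id t ≡ t
  mapArgs-id (app f ts) = ≡.cong (app f) (map-id ts)

  mapArgs-∘ : ∀ σ τ t → mapArgs {S} (σ ∘ τ) t ≡ mapArgs σ (mapArgs τ t)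
  mapArgs-∘ σ τ (app f ts) = ≡.cong (app f) (map-∘ σ τ ts)

  sub-self : ∀ a b → sub {S} a b a ≡ b
  sub-self a b with a ≟ a
  ... | yes _  = refl
  ... | no a≢a = contradiction refl a≢a

  sub-target : ∀ a b → sub {S} a b b ≡ b
  sub-target a b with a ≟ b
  ... | yes _ = refl
  ... | no _  = refl

  assoc-∈ : ∀ {A : Set} k (xs : List (Term S × A)) {a} → assoc k xs ≡ just a → (k , a) ∈ xs
  assoc-∈ k ((l , b) ∷ xs) eq with k ≟ l
  assoc-∈ k ((l , b) ∷ xs) refl | yes refl = here refl
  ... | no _     = there (assoc-∈ k xs eq)

  deterministic-assoc : ∀ {Δ : Rules S} → Deterministic Δ → ∀ {l r} → (l , r) ∈ Δ → assoc l Δ ≡ just r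
  deterministic-assoc (fresh ∷ d) {l} (here refl) with l ≟ l
  ... | yes _  = refl
  ... | no l≢l = contradiction refl l≢l
  deterministic-assoc {(l′ , _) ∷ _} (fresh ∷ d) {l} (there x∈) with l ≟ l′
  ... | yes refl = contradiction (≡.trans (≡.sym fresh) (deterministic-assoc d x∈)) λ ()
  ... | no _     = deterministic-assoc d x∈

  Duplicate-⊆ : ∀ {a b : Term S} {Δ Δ′ x} → Duplicate a b Δ Δ′ → x ∈ Δ′ → x ∈ Δ
  Duplicate-⊆ (here _)  x∈         = there x∈
  Duplicate-⊆ (there d) (here eq)  = here eq
  Duplicate-⊆ (there d) (there x∈) = there (Duplicate-⊆ d x∈)

  Duplicate-rules : ∀ {a b : Term S} {Δ Δ′} → Duplicate a b Δ Δ′ → ∃[ l ] (l , a) ∈ Δ × (l , b) ∈ Δ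
  Duplicate-rules (here {l} {Δ} eq) = l , here refl , there (assoc-∈ l Δ eq)
  Duplicate-rules (there d) with l , a∈ , b∈ ← Duplicate-rules d = l , there a∈ , there b∈

  -- Nothing is lost by the deletion: the rule `l → a` lives on as `l → b`, which is the same rule
  -- once `a` has been renamed to `b`.
  Duplicate-split : ∀ {a b : Term S} {Δ Δ′ l r} → Duplicate a b Δ Δ′ → (l , r) ∈ Δ →
                    (l , r) ∈ Δ′ ⊎ (r ≡ a × (l , b) ∈ Δ′)
  Duplicate-split (here {l} {Δ} eq) (here refl) = inj₂ (refl , assoc-∈ l Δ eq)
  Duplicate-split (here eq)         (there x∈)  = inj₁ x∈
  Duplicate-split (there d)         (here eq)   = inj₁ (here eq)
  Duplicate-split (there d)         (there x∈) with Duplicate-split d x∈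
  ... | inj₁ x∈′        = inj₁ (there x∈′)
  ... | inj₂ (eq , x∈′) = inj₂ (eq , there x∈′)

  Duplicate-length : ∀ {a b : Term S} {Δ Δ′} → Duplicate a b Δ Δ′ → length Δ ≡ suc (length Δ′)
  Duplicate-length (here _)  = refl
  Duplicate-length (there d) = ≡.cong suc (Duplicate-length d)

  -- Merging of states

  module _ (Γ : Equations S) where

    Pointwise-map : ∀ {σ n} → (∀ s → Γ ⊢ s ∼ σ s) → (ts : Vec (Term S) n) → Pointwise (Γ ⊢_∼_) ts (Vec.map σ ts)
    Pointwise-map s∼ []       = []
    Pointwise-map s∼ (t ∷ ts) = s∼ t ∷ Pointwise-map s∼ ts

    mapArgs-∼ : ∀ {σ} → (∀ s → Γ ⊢ s ∼ σ s) → ∀ t → Γ ⊢ t ∼ mapArgs σ t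
    mapArgs-∼ s∼ (app f ts) = cong f (Pointwise-map s∼ ts)

    sub-∼ : ∀ {a b} → Γ ⊢ a ∼ b → ∀ s → Γ ⊢ s ∼ sub a b s
    sub-∼ {a} a∼b s with a ≟ s
    ... | yes refl = a∼b
    ... | no _     = refl

  -- What correctness uses of the initial rules. By the two closure properties, each argument of a
  -- left-hand side and each right-hand side has its own rule `s → s`; this is why every state is
  -- reached by some term.
  record Start (Γ : Equations S) (N : ℕ) (Δ₀ : Rules S) : Set where
    field
      axioms  : ∀ {p q} → (p , q) ∈ Γ → (p , q) ∈ Δ₀
      valid   : ∀ {p q} → (p , q) ∈ Δ₀ → Γ ⊢ p ∼ q
      closedˡ : ∀ {f ps q} → (app f ps , q) ∈ Δ₀ → AllV (λ s → (s , s) ∈ Δ₀) ps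
      closedʳ : ∀ {p q} → (p , q) ∈ Δ₀ → (q , q) ∈ Δ₀
      smallˡ  : ∀ {p q} → (p , q) ∈ Δ₀ → ∣ p ∣ᵗ ≤ N
      smallʳ  : ∀ {p q} → (p , q) ∈ Δ₀ → ∣ q ∣ᵗ ≤ N

  module Semantics {Γ : Equations S} {N : ℕ} {Δ₀ : Rules S} (start : Start Γ N Δ₀) where
    open Start start

    -- Up to order and multiplicity, Δ is the image of Δ₀ under σ.
    record Invariant (σ : Term S → Term S) (Δ : Rules S) : Set where
      field
        σ-sound   : ∀ s → Γ ⊢ s ∼ σ s
        σ-bounded : ∀ s → ∣ s ∣ᵗ ≤ N → ∣ σ s ∣ᵗ ≤ N
        image     : ∀ {p q} → (p , q) ∈ Δ₀ → (mapArgs σ p , σ q) ∈ Δ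
        preimage  : ∀ {l r} → (l , r) ∈ Δ → ∃[ p ] ∃[ q ] (p , q) ∈ Δ₀ × l ≡ mapArgs σ p × r ≡ σ q

      rule-valid : ∀ {l r} → (l , r) ∈ Δ → Γ ⊢ l ∼ r
      rule-valid lr∈ with p , q , pq∈ , refl , refl ← preimage lr∈ =
        trans (sym (mapArgs-∼ Γ σ-sound p)) (trans (valid pq∈) (σ-sound q))

      preimage-args : ∀ {f} {cs : Vec (Term S) (arity S f)} {r} → (app f cs , r) ∈ Δ →
                      ∃[ ps ] ∃[ q ] (app f ps , q) ∈ Δ₀ × cs ≡ Vec.map σ ps × r ≡ σ q
      preimage-args c∈ with app f ps , q , pq∈ , refl , r≡ ← preimage c∈ = ps , q , pq∈ , refl , r≡

    invariant-id : Invariant id Δ₀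
    invariant-id = record
      { σ-sound   = λ _ → refl
      ; σ-bounded = λ _ s≤ → s≤
      ; image     = λ {p} {q} pq∈ → ≡.subst (λ l → (l , q) ∈ Δ₀) (≡.sym (mapArgs-id p)) pq∈
      ; preimage  = λ {l} {r} lr∈ → l , r , lr∈ , ≡.sym (mapArgs-id l) , refl
      }

    -- The states `a` and `b` are congruent, being right-hand sides for the same `l`. The size bound
    -- survives because `b` is the image of an initial right-hand side and so already within `N`.
    invariant-sub : ∀ {σ a b Δ Δ′} → Invariant σ Δ → Duplicate a b Δ Δ′ →
                    Invariant (sub a b ∘ σ) (rename (sub a b) Δ′)
    invariant-sub {σ} {a} {b} {Δ} {Δ′} inv dup = record
      { σ-sound   = λ s → trans (σ-sound s) (sub-∼ Γ a∼b (σ s))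
      ; σ-bounded = bounded′
      ; image     = image′
      ; preimage  = preimage′
      }
      where
      open Invariant inv
      a∼b : Γ ⊢ a ∼ b
      a∼b with _ , la∈ , lb∈ ← Duplicate-rules dup = trans (sym (rule-valid la∈)) (rule-valid lb∈)

      b≤ : ∣ b ∣ᵗ ≤ N
      b≤ with _ , _ , lb∈ ← Duplicate-rules dup with _ , q , pq∈ , _ , refl ← preimage lb∈ =
        σ-bounded q (smallʳ pq∈)

      bounded′ : ∀ s → ∣ s ∣ᵗ ≤ N → ∣ sub a b (σ s) ∣ᵗ ≤ N
      bounded′ s s≤ with a ≟ σ s
      ... | yes _ = b≤
      ... | no _  = σ-bounded s s≤

      image′ : ∀ {p q} → (p , q) ∈ Δ₀ → (mapArgs (sub a b ∘ σ) p , sub a b (σ q)) ∈ rename (sub a b) Δ′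
      image′ {p} {q} pq∈ rewrite mapArgs-∘ (sub a b) σ p with Duplicate-split dup (image pq∈)
      ... | inj₁ ∈Δ′        = ∈-map⁺ _ ∈Δ′
      -- Here `σ q` is the merged state `a`, and the image is the renamed rule `l → b`: the
      -- substitution sends `a` to `b` and fixes `b`.
      ... | inj₂ (eq , ∈Δ′) rewrite eq | sub-self a b =
        ≡.subst (λ c → (mapArgs (sub a b) (mapArgs σ p) , c) ∈ rename (sub a b) Δ′) (sub-target a b) (∈-map⁺ _ ∈Δ′)

      preimage′ : ∀ {l r} → (l , r) ∈ rename (sub a b) Δ′ →
                  ∃[ p ] ∃[ q ] (p , q) ∈ Δ₀ × l ≡ mapArgs (sub a b ∘ σ) p × r ≡ sub a b (σ q)
      preimage′ lr∈ with (l , r) , lr∈′ , refl ← ∈-map⁻ _ lr∈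
        with p , q , pq∈ , refl , refl ← preimage (Duplicate-⊆ dup lr∈′) =
        p , q , pq∈ , ≡.sym (mapArgs-∘ (sub a b) σ p) , refl

    -- Runs of the deterministic automaton

    module Automaton {σ : Term S → Term S} {Δ : Rules S} (inv : Invariant σ Δ) (det : Deterministic Δ) where
      open Invariant inv

      -- Δ as a bottom-up tree automaton: a run on s ends in the state
      -- representing the class of s, or gets stuck.
      mutual
        step : Term S → Maybe (Term S)
        step (app f ts) = Maybe.map (app f) (runs ts)

        run : Term S → Maybe (Term S)
        run t = step t >>= λ l → assoc l Δ

        runs : ∀ {n} → Vec (Term S) n → Maybe (Vec (Term S) n)
        runs []       = just []
        runs (t ∷ ts) = zipWith _∷_ (run t) (runs ts)

      run-step⁻ : ∀ s {c} → run s ≡ just c → ∃[ l ] (l , c) ∈ Δ × step s ≡ just l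
      run-step⁻ s eq with step s
      ... | just l = l , assoc-∈ l Δ eq , refl

      run-step⁺ : ∀ s {c l} → (l , c) ∈ Δ → step s ≡ just l → run s ≡ just c
      run-step⁺ s lc∈ eq with step s
      run-step⁺ s lc∈ refl | just l = deterministic-assoc det lc∈

      step⁻ : ∀ f ts {l} → step (app f ts) ≡ just l → ∃[ cs ] runs ts ≡ just cs × l ≡ app f cs
      step⁻ f ts eq with runs ts
      step⁻ f ts refl | just cs = cs , refl , refl

      mutual
        run-sound : ∀ s {c} → run s ≡ just c → Γ ⊢ s ∼ c
        run-sound (app f ts) eq with l , lc∈ , st ← run-step⁻ (app f ts) eq
          with cs , rs , refl ← step⁻ f ts st = trans (cong f (runs-sound ts rs)) (rule-valid lc∈)

        runs-sound : ∀ {n} (ts : Vec (Term S) n) {cs} → runs ts ≡ just cs → Pointwise (Γ ⊢_∼_) ts cs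
        runs-sound []       refl = []
        runs-sound (t ∷ ts) eq with c , cs , r , rs , refl ← zipWith-just⁻ _∷_ (run t) (runs ts) eq =
          run-sound t r ∷ runs-sound ts rs

      mutual
        -- By structural induction: the arguments have their own rules and so run to their images
        -- under `σ`, and `image` supplies a rule for the left-hand side formed by these.
        run-subterm : ∀ s → (s , s) ∈ Δ₀ → run s ≡ just (σ s)
        run-subterm (app f ts) s∈ = run-rule-app f ts s∈

        run-rule-app : ∀ f ts {q} → (app f ts , q) ∈ Δ₀ → run (app f ts) ≡ just (σ q)
        run-rule-app f ts pq∈ = run-step⁺ (app f ts) (image pq∈)
          (≡.cong (Maybe.map (app f)) (runs-subterms ts (closedˡ pq∈)))

        runs-subterms : ∀ {n} (ts : Vec (Term S) n) → AllV (λ s → (s , s) ∈ Δ₀) ts → runs ts ≡ just (Vec.map σ ts)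
        runs-subterms []       []         = refl
        runs-subterms (t ∷ ts) (t∈ ∷ ts∈) rewrite run-subterm t t∈ | runs-subterms ts ts∈ = refl

      mutual
        -- A derivation may pass through terms on which the automaton is stuck. Comparing results in
        -- `Maybe` covers these too and makes all cases but the axioms immediate. For an axiom, the
        -- rule `p → q` sends `p` to `σ q`, and `q` reaches `σ q` by its own rule.
        run-cong : ∀ {s t} → Γ ⊢ s ∼ t → run s ≡ run t
        run-cong (axiom {app f ps} {q} pq∈) = ≡.trans (run-rule-app f ps (axioms pq∈))
          (≡.sym (run-subterm q (closedʳ (axioms pq∈))))
        run-cong refl        = refl
        run-cong (sym d)     = ≡.sym (run-cong d)
        run-cong (trans d e) = ≡.trans (run-cong d) (run-cong e)
        run-cong (cong f ds) = ≡.cong (λ m → Maybe.map (app f) m >>= λ l → assoc l Δ) (runs-cong ds)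

        runs-cong : ∀ {n} {ss ts : Vec (Term S) n} → Pointwise (Γ ⊢_∼_) ss ts → runs ss ≡ runs ts
        runs-cong []       = refl
        runs-cong (d ∷ ds) = ≡.cong₂ (zipWith _∷_) (run-cong d) (runs-cong ds)

      run-class⁺ : ∀ {s t} → (t , t) ∈ Δ₀ → Γ ⊢ s ∼ t → run s ≡ just (σ t)
      run-class⁺ {t = t} t∈ s∼t = ≡.trans (run-cong s∼t) (run-subterm t t∈)

      run-class⁻ : ∀ {s t} → run s ≡ just (σ t) → Γ ⊢ s ∼ t
      run-class⁻ {s} {t} eq = trans (run-sound s eq) (sym (σ-sound t))

      -- Counting the terms that run to a state

      Counts : Table S → Set
      Counts D = ∀ {c m} → assoc c D ≡ just m → Enumeration (λ s → run s ≡ just c) m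

      module _ {D : Table S} (counts : Counts D) where

        product-enumeration : ∀ {n} (cs : Vec (Term S) n) {m} → product D cs ≡ just m →
                              Enumeration (λ ts → runs ts ≡ just cs) m
        product-enumeration []       refl = record
          { elements = [] ∷ []
          ; unique   = [] ∷ []
          ; sound    = λ { (here refl) → refl }
          ; complete = λ { {[]} _ → here refl }
          ; length≡  = refl
          }
        product-enumeration (c ∷ cs) eq
          with a , b , eqᵃ , eqᵇ , refl ← zipWith-just⁻ _*_ (assoc c D) (product D cs) eq = record
          { elements = cartesianProductWith _∷_ (elements E) (elements F)
          ; unique   = Unique.cartesianProductWith⁺ _∷_ ∷-injective (unique E) (unique F)
          ; sound    = sound′
          ; complete = complete′
          ; length≡  = ≡.trans (length-cartesianProductWith _∷_ (elements E) (elements F))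
                         (≡.cong₂ _*_ (length≡ E) (length≡ F))
          }
          where
          E = counts eqᵃ
          F = product-enumeration cs eqᵇ
          sound′ : ∀ {ts} → ts ∈ cartesianProductWith _∷_ (elements E) (elements F) → runs ts ≡ just (c ∷ cs)
          sound′ ts∈ with t , ts , t∈ , ts∈′ , refl ← ∈-cartesianProductWith⁻ _∷_ (elements E) (elements F) ts∈ =
            ≡.cong₂ (zipWith _∷_) (sound E t∈) (sound F ts∈′)
          complete′ : ∀ {ts} → runs ts ≡ just (c ∷ cs) → ts ∈ cartesianProductWith _∷_ (elements E) (elements F)
          complete′ {t ∷ ts} rs with _ , _ , r , rs′ , refl ← zipWith-just⁻ _∷_ (run t) (runs ts) rs =
            ∈-cartesianProductWith⁺ _∷_ (complete E r) (complete F rs′)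

        -- The induction is on a part `Δ′` of the rules whereas runs use all of `Δ`; hence the terms
        -- are described by the left-hand side that `step` gives, not by `run`. A term has at most
        -- one such left-hand side, and determinism gives the latter only one rule, so no term is
        -- counted twice.
        total-enumeration : ∀ c {Δ′} → Deterministic Δ′ → ∀ {m} → total D c Δ′ ≡ just m →
                            Enumeration (λ s → ∃[ l ] (l , c) ∈ Δ′ × step s ≡ just l) m
        total-enumeration c {[]} [] refl = record
          { elements = []
          ; unique   = []
          ; sound    = λ ()
          ; complete = λ ()
          ; length≡  = refl
          }
        total-enumeration c {(app f cs , r) ∷ Δ′} (fresh ∷ d) eq with c ≟ r
        ... | no c≢r = Enumeration-⇔
          (λ (l , lc∈ , st) → l , there lc∈ , st)
          (λ { (l , here refl , st) → contradiction refl c≢r ; (l , there lc∈ , st) → l , lc∈ , st })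
          (total-enumeration c d eq)
        ... | yes refl with a , b , eqᵃ , eqᵇ , refl ← zipWith-just⁻ _+_ (product D cs) (total D c Δ′) eq = record
          { elements = map (app f) (elements E) ++ elements F
          ; unique   = Unique.++⁺ (Unique.map⁺ app-injective (unique E)) (unique F) disjoint
          ; sound    = sound′
          ; complete = complete′
          ; length≡  = ≡.trans (length-++ (map (app f) (elements E)))
                         (≡.cong₂ _+_ (≡.trans (length-map (app f) (elements E)) (length≡ E)) (length≡ F))
          }
          where
          E = product-enumeration cs eqᵃ
          F = total-enumeration c d eqᵇ
          soundˡ : ∀ {s} → s ∈ map (app f) (elements E) → step s ≡ just (app f cs)
          soundˡ s∈ with ts , ts∈ , refl ← ∈-map⁻ (app f) s∈ = ≡.cong (Maybe.map (app f)) (sound E ts∈)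
          disjoint : ∀ {s} → s ∈ map (app f) (elements E) × s ∈ elements F → _
          disjoint (s∈ˡ , s∈ʳ) with l , lc∈ , st ← sound F s∈ʳ
            with refl ← just-injective (≡.trans (≡.sym (soundˡ s∈ˡ)) st) =
            contradiction (≡.trans (≡.sym fresh) (deterministic-assoc d lc∈)) λ ()
          sound′ : ∀ {s} → s ∈ map (app f) (elements E) ++ elements F →
                   ∃[ l ] (l , c) ∈ (app f cs , c) ∷ Δ′ × step s ≡ just l
          sound′ s∈ with ∈-++⁻ (map (app f) (elements E)) s∈
          ... | inj₁ s∈ˡ = _ , here refl , soundˡ s∈ˡ
          ... | inj₂ s∈ʳ with l , lc∈ , st ← sound F s∈ʳ = l , there lc∈ , st
          complete′ : ∀ {s} → ∃[ l ] (l , c) ∈ (app f cs , c) ∷ Δ′ × step s ≡ just l →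
                      s ∈ map (app f) (elements E) ++ elements F
          complete′ {app g ts} (l , here refl , st) with _ , rs , refl ← step⁻ g ts st =
            ∈-++⁺ˡ (∈-map⁺ (app f) (complete E rs))
          complete′ (l , there lc∈ , st) = ∈-++⁺ʳ (map (app f) (elements E)) (complete F (l , lc∈ , st))

        state-enumeration : ∀ {c m} → total D c Δ ≡ just m → Enumeration (λ s → run s ≡ just c) m
        state-enumeration {c} eq = Enumeration-⇔
          (λ {s} (_ , lc∈ , st) → run-step⁺ s lc∈ st) (λ {s} → run-step⁻ s) (total-enumeration c det eq)

      Counts-∷ : ∀ {D c m} → Counts D → total D c Δ ≡ just m → Counts ((c , m) ∷ D)
      Counts-∷ {c = c} counts tot {c′} eq with c′ ≟ c
      Counts-∷ {c = c} counts tot refl | yes refl = state-enumeration counts tot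
      ... | no _     = counts eq

      -- States with infinitely many terms

      product-nothing⁻ : ∀ {n} D (cs : Vec (Term S) n) → product D cs ≡ nothing →
                         ∃[ i ] assoc (lookup cs i) D ≡ nothing
      product-nothing⁻ D (c ∷ cs) eq with zipWith-nothing⁻ _*_ (assoc c D) (product D cs) eq
      ... | inj₁ e = zero , e
      ... | inj₂ e with i , e′ ← product-nothing⁻ D cs e = suc i , e′

      total-nothing⁻ : ∀ D c (Δ′ : Rules S) → total D c Δ′ ≡ nothing →
                       ∃[ f ] ∃[ cs ] (app f cs , c) ∈ Δ′ × product D cs ≡ nothing
      total-nothing⁻ D c ((app f cs , r) ∷ Δ′) eq with c ≟ r
      total-nothing⁻ D c ((app f cs , r) ∷ Δ′) eq | yes refl
        with zipWith-nothing⁻ _+_ (product D cs) (total D c Δ′) eq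
      ... | inj₁ e = f , cs , here refl , e
      ... | inj₂ e with f′ , cs′ , c∈ , e′ ← total-nothing⁻ D c Δ′ e = f′ , cs′ , there c∈ , e′
      total-nothing⁻ D c ((app f cs , r) ∷ Δ′) eq | no _
        with f′ , cs′ , c∈ , e′ ← total-nothing⁻ D c Δ′ eq = f′ , cs′ , there c∈ , e′

      runs-update : ∀ {n} (ts : Vec (Term S) n) i s {cs} → runs ts ≡ just cs → run s ≡ just (lookup cs i) →
                    runs (ts [ i ]≔ s) ≡ just cs
      runs-update (t ∷ ts) i s eq r with zipWith-just⁻ _∷_ (run t) (runs ts) eq
      runs-update (t ∷ ts) zero    s eq r | c , cs , r′ , rs , refl = ≡.cong₂ (zipWith _∷_) r rs
      runs-update (t ∷ ts) (suc i) s eq r | c , cs , r′ , rs , refl =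
        ≡.cong₂ (zipWith _∷_) r′ (runs-update ts i s rs r)

      ∣update∣≥ : ∀ {n} (ts : Vec (Term S) n) i s → ∣ s ∣ᵗ ≤ ∣ ts [ i ]≔ s ∣ᵗˢ
      ∣update∣≥ (t ∷ ts) zero    s = m≤m+n _ _
      ∣update∣≥ (t ∷ ts) (suc i) s = ≤-trans (∣update∣≥ ts i s) (m≤n+m _ _)

      module _ {D : Table S} (stuck : ∀ {l r} → (l , r) ∈ Δ → assoc r D ≡ nothing → total D r Δ ≡ nothing) where

        -- Traces the arguments back to initial terms `ps` with rules of their own: the missing one
        -- is again a state to which the induction applies, and the others are states that `ps`
        -- provides terms for.
        missing-argument : ∀ {f} {cs : Vec (Term S) (arity S f)} {c} → (app f cs , c) ∈ Δ → product D cs ≡ nothing →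
          ∃[ ps ] ∃[ i ] AllV (λ s → (s , s) ∈ Δ₀) ps × cs ≡ Vec.map σ ps × assoc (σ (lookup ps i)) D ≡ nothing
        missing-argument {cs = cs} c∈ e with preimage-args c∈ | product-nothing⁻ D cs e
        ... | ps , _ , pq∈ , refl , _ | i , missing =
          ps , i , closedˡ pq∈ , refl , ≡.subst (λ x → assoc x D ≡ nothing) (lookup-map i σ ps) missing

        -- Every state missing from a stuck table has a rule with a missing
        -- state among its arguments.
        large-term : ∀ k {l c} → (l , c) ∈ Δ → assoc c D ≡ nothing → ∃[ s ] run s ≡ just c × k ≤ ∣ s ∣ᵗ
        large-term zero    lc∈ missing with _ , q , pq∈ , _ , refl ← preimage lc∈ =
          q , run-subterm q (closedʳ pq∈) , z≤n
        large-term (suc k) {c = c} lc∈ missing = grow (total-nothing⁻ D c Δ (stuck lc∈ missing))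
          where
          grow : ∃[ f ] ∃[ cs ] (app f cs , c) ∈ Δ × product D cs ≡ nothing → ∃[ s ] run s ≡ just c × suc k ≤ ∣ s ∣ᵗ
          grow (f , cs , c∈ , e) with missing-argument c∈ e
          ... | ps , i , ps∈ , refl , missing′ with large-term k (image (lookup⁺ ps∈ i)) missing′
          -- The term `s` takes the place of the missing argument, the others stay as in `ps`; the
          -- root adds the one node still wanted.
          ... | s , r , k≤ =
            app f (ps [ i ]≔ s)
            , run-step⁺ (app f (ps [ i ]≔ s)) c∈ (≡.cong (Maybe.map (app f))
                (runs-update ps i s (runs-subterms ps ps∈) (≡.trans r (≡.cong just (≡.sym (lookup-map i σ ps))))))
            , s≤s (≤-trans k≤ (∣update∣≥ ps i s))

      classSize : ∀ {t} → (t , t) ∈ Δ₀ → ∀ {D} → Counts D →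
        (∀ {l r} → (l , r) ∈ Δ → assoc r D ≡ nothing → total D r Δ ≡ nothing) →
        ∀ {m} → assoc (σ t) D ≡ m → HasSize (CongruenceClass Γ t) (Maybe.maybe′ fin ∞ m)
      classSize {t} t∈ counts stuck {just m} eq with counts eq
      ... | record { elements = xs ; unique = unique ; sound = sound ; complete = complete ; length≡ = refl } =
        finite record
          { to        = λ i → Data.List.lookup xs i , run-class⁻ (sound (∈-lookup i))
          ; cong      = λ { refl → refl }
          ; bijective = lookup-injective unique
            , λ { (s , s∼t) → let s∈ = complete (run-class⁺ t∈ s∼t) in
                  index s∈ , λ { refl → ≡.sym (lookup-index s∈) } }
          }
      classSize {t} t∈ {D} counts stuck {nothing} missing = infinite record
        { to        = λ k → proj₁ (sequence k) , proj₂ (sequence k)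
        ; cong      = λ { refl → refl }
        ; injective = sequence-injective
        }
        where
        large : ∀ k → ∃[ s ] run s ≡ just (σ t) × k ≤ ∣ s ∣ᵗ
        large k = large-term stuck k (image t∈) missing

        -- Each term is chosen larger than the one before; strict growth in size makes the sequence
        -- injective.
        sequence : ℕ → ∃[ s ] Γ ⊢ s ∼ t
        sequence zero    = t , refl
        sequence (suc k) with s , r , _ ← large (suc ∣ proj₁ (sequence k) ∣ᵗ) = s , run-class⁻ r

        sequence-< : ∀ k → ∣ proj₁ (sequence k) ∣ᵗ < ∣ proj₁ (sequence (suc k)) ∣ᵗ
        sequence-< k with _ , _ , s> ← large (suc ∣ proj₁ (sequence k) ∣ᵗ) = s>

        sequence-mono : ∀ {i j} → i < j → ∣ proj₁ (sequence i) ∣ᵗ < ∣ proj₁ (sequence j) ∣ᵗ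
        sequence-mono {i} {suc j} (s≤s i≤j) with m≤n⇒m<n∨m≡n i≤j
        ... | inj₁ i<j  = <-trans (sequence-mono i<j) (sequence-< j)
        ... | inj₂ refl = sequence-< i

        sequence-injective : ∀ {i j} → proj₁ (sequence i) ≡ proj₁ (sequence j) → i ≡ j
        sequence-injective {i} {j} eq with <-cmp i j
        ... | tri< i<j _ _ = contradiction (≡.cong ∣_∣ᵗ eq) (<⇒≢ (sequence-mono i<j))
        ... | tri≈ _ i≡j _ = i≡j
        ... | tri> _ _ j<i = contradiction (≡.cong ∣_∣ᵗ (≡.sym eq)) (<⇒≢ (sequence-mono j<i))

-- Polynomial bounds

Polynomial : (ℕ → ℕ) → Set
Polynomial f = ∃[ c ] ∃[ d ] (∀ N → 1 ≤ N → f N ≤ c * N ^ d)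

const-polynomial : ∀ k → Polynomial (λ _ → k)
const-polynomial k = k , 0 , λ _ _ → ≤-reflexive (≡.sym (*-identityʳ k))

id-polynomial : Polynomial (λ N → N)
id-polynomial = 1 , 1 , λ N _ → ≤-reflexive (≡.sym (≡.trans (*-identityˡ (N ^ 1)) (*-identityʳ N)))

^-monoʳ-≤′ : ∀ {N} → 1 ≤ N → ∀ {d e} → d ≤ e → N ^ d ≤ N ^ e
^-monoʳ-≤′ {suc N} _ = ^-monoʳ-≤ (suc N)

infixl 6 _+ᴾ_
infixl 7 _*ᴾ_

-- The sum `d + d′` serves as a common degree; raising an exponent to it is where `1 ≤ N` is used.
_+ᴾ_ : ∀ {f g} → Polynomial f → Polynomial g → Polynomial (λ N → f N + g N)
(c , d , p) +ᴾ (c′ , d′ , q) = c + c′ , d + d′ , λ N 1≤N → ≤-trans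
  (+-mono-≤ (≤-trans (p N 1≤N) (*-monoʳ-≤ c (^-monoʳ-≤′ 1≤N (m≤m+n d d′))))
            (≤-trans (q N 1≤N) (*-monoʳ-≤ c′ (^-monoʳ-≤′ 1≤N (m≤n+m d′ d)))))
  (≤-reflexive (≡.sym (*-distribʳ-+ (N ^ (d + d′)) c c′)))

_*ᴾ_ : ∀ {f g} → Polynomial f → Polynomial g → Polynomial (λ N → f N * g N)
(c , d , p) *ᴾ (c′ , d′ , q) = c * c′ , d + d′ , λ N 1≤N → ≤-trans
  (*-mono-≤ (p N 1≤N) (q N 1≤N))
  (≤-reflexive (≡.trans (interchange c (N ^ d) c′ (N ^ d′)) (≡.cong (c * c′ *_) (≡.sym (^-distribˡ-+-* N d d′)))))
  where
  interchange : ∀ a x b y → (a * x) * (b * y) ≡ (a * b) * (x * y)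
  interchange = solve-∀

sucᴾ : ∀ {f} → Polynomial f → Polynomial (λ N → suc (f N))
sucᴾ p = const-polynomial 1 +ᴾ p

-- Encoded sizes

∣encodeSymbol∣≤ : ∀ {k} (f : Fin k) → ∣ encodeSymbol f ∣ᵛ ≤ 2 * k
∣encodeSymbol∣≤ {suc k} zero    = s≤s z≤n
∣encodeSymbol∣≤ {suc k} (suc f) =
  ≤-trans (s≤s (s≤s (∣encodeSymbol∣≤ f))) (≤-reflexive (≡.sym (*-suc 2 k)))

module _ {S : Signature} where

  -- What one node of a term adds to the code: at most `2 * #symbols S` for its symbol, and three
  -- more for the pair of symbol and arguments, the `nil` that ends the arguments, and the pair that
  -- enters the term in a list. The strict inequality below reserves the last of these.
  nodeSize : ℕ
  nodeSize = 3 + 2 * #symbols S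

  mutual
    size<nodeSize*∣∣ : (t : Term S) → size t < nodeSize * ∣ t ∣ᵗ
    size<nodeSize*∣∣ (app f ts) = begin
      2 + (∣ encodeSymbol f ∣ᵛ + ∣ encodeTerms ts ∣ᵛ)
        ≤⟨ +-monoʳ-≤ 2 (+-mono-≤ (∣encodeSymbol∣≤ f) (∣encodeTerms∣≤ ts)) ⟩
      2 + (2 * #symbols S + suc (nodeSize * ∣ ts ∣ᵗˢ))
        ≡⟨ rearrange (2 * #symbols S) (nodeSize * ∣ ts ∣ᵗˢ) ⟩
      nodeSize + nodeSize * ∣ ts ∣ᵗˢ                                 ≡⟨ *-suc nodeSize ∣ ts ∣ᵗˢ ⟨
      nodeSize * suc ∣ ts ∣ᵗˢ                                        ∎
      where
      open ≤-Reasoning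
      rearrange : ∀ a b → 2 + (a + suc b) ≡ 3 + a + b
      rearrange = solve-∀

    ∣encodeTerms∣≤ : ∀ {n} (ts : Vec (Term S) n) → ∣ encodeTerms ts ∣ᵛ ≤ suc (nodeSize * ∣ ts ∣ᵗˢ)
    ∣encodeTerms∣≤ []       = s≤s z≤n
    ∣encodeTerms∣≤ (t ∷ ts) = begin
      suc (size t) + ∣ encodeTerms ts ∣ᵛ
        ≤⟨ +-mono-≤ (size<nodeSize*∣∣ t) (∣encodeTerms∣≤ ts) ⟩
      nodeSize * ∣ t ∣ᵗ + suc (nodeSize * ∣ ts ∣ᵗˢ)            ≡⟨ +-suc (nodeSize * ∣ t ∣ᵗ) _ ⟩
      suc (nodeSize * ∣ t ∣ᵗ + nodeSize * ∣ ts ∣ᵗˢ)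
        ≡⟨ ≡.cong suc (*-distribˡ-+ nodeSize ∣ t ∣ᵗ ∣ ts ∣ᵗˢ) ⟨
      suc (nodeSize * (∣ t ∣ᵗ + ∣ ts ∣ᵗˢ))                     ∎
      where open ≤-Reasoning

  ∣encodeEquations∣≤ : (Γ : Equations S) → ∣ encodeEquations Γ ∣ᵛ ≤ suc (nodeSize * ∣ Γ ∣ᴳ)
  ∣encodeEquations∣≤ []            = s≤s z≤n
  ∣encodeEquations∣≤ ((p , q) ∷ Γ) = begin
    2 + (size p + size q + ∣ encodeEquations Γ ∣ᵛ)
      ≡⟨ rearrange (size p) (size q) _ ⟩
    suc (size p) + suc (size q) + ∣ encodeEquations Γ ∣ᵛ
      ≤⟨ +-mono-≤ (+-mono-≤ (size<nodeSize*∣∣ p) (size<nodeSize*∣∣ q)) (∣encodeEquations∣≤ Γ) ⟩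
    nodeSize * ∣ p ∣ᵗ + nodeSize * ∣ q ∣ᵗ + suc (nodeSize * ∣ Γ ∣ᴳ)
      ≡⟨ factor nodeSize ∣ p ∣ᵗ ∣ q ∣ᵗ ∣ Γ ∣ᴳ ⟩
    suc (nodeSize * (∣ p ∣ᵗ + ∣ q ∣ᵗ + ∣ Γ ∣ᴳ))                                     ∎
    where
    open ≤-Reasoning
    rearrange : ∀ a b c → 2 + (a + b + c) ≡ suc a + suc b + c
    rearrange = solve-∀
    factor : ∀ w a b c → w * a + w * b + suc (w * c) ≡ suc (w * (a + b + c))
    factor = solve-∀

  arity≤∣∣ : ∀ {n} (ts : Vec (Term S) n) → n ≤ ∣ ts ∣ᵗˢ
  arity≤∣∣ []              = z≤n
  arity≤∣∣ (app f us ∷ ts) = s≤s (≤-trans (arity≤∣∣ ts) (m≤n+m _ _))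

  1≤∣∣ : (t : Term S) → 1 ≤ ∣ t ∣ᵗ
  1≤∣∣ (app f ts) = s≤s z≤n

  -- The initial rules

  Closed : Rules S → Set
  Closed X = ∀ {f ps q} → (app f ps , q) ∈ X → AllV (λ s → (s , s) ∈ X) ps × (q , q) ∈ X

  Closed-++ : ∀ {X Y} → Closed X → Closed Y → Closed (X ++ Y)
  Closed-++ {X} closedX closedY pq∈ with ∈-++⁻ X pq∈
  ... | inj₁ ∈X = Product.map (VAll.map ∈-++⁺ˡ) ∈-++⁺ˡ (closedX ∈X)
  ... | inj₂ ∈Y = Product.map (VAll.map (∈-++⁺ʳ X)) (∈-++⁺ʳ X) (closedY ∈Y)

  Closed-∷ : ∀ {p q X} → (p , p) ∈ X → (q , q) ∈ X → Closed X → Closed ((p , q) ∷ X)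
  Closed-∷ pp∈ qq∈ closed (here refl) = VAll.map there (proj₁ (closed pp∈)) , there qq∈
  Closed-∷ pp∈ qq∈ closed (there x∈)  = Product.map (VAll.map there) there (closed x∈)

  diag-root : ∀ t → (t , t) ∈ diag {S} t
  diag-root (app f ts) = here refl

  diags-roots : ∀ {n} (ts : Vec (Term S) n) → AllV (λ s → (s , s) ∈ diags ts) ts
  diags-roots []       = []
  diags-roots (t ∷ ts) = ∈-++⁺ˡ (diag-root t) ∷ VAll.map (∈-++⁺ʳ (diag t)) (diags-roots ts)

  mutual
    diag-closed : ∀ t → Closed (diag t)
    diag-closed (app f ts) (here refl) = VAll.map there (diags-roots ts) , here refl
    diag-closed (app f ts) (there x∈)  = Product.map (VAll.map there) there (diags-closed ts x∈)

    diags-closed : ∀ {n} (ts : Vec (Term S) n) → Closed (diags ts)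
    diags-closed []       ()
    diags-closed (t ∷ ts) = Closed-++ (diag-closed t) (diags-closed ts)

  mutual
    diag-diagonal : ∀ t {p q} → (p , q) ∈ diag {S} t → p ≡ q × ∣ p ∣ᵗ ≤ ∣ t ∣ᵗ
    diag-diagonal (app f ts) (here refl) = refl , ≤-refl
    diag-diagonal (app f ts) (there x∈)  = Product.map₂ m≤n⇒m≤1+n (diags-diagonal ts x∈)

    diags-diagonal : ∀ {n} (ts : Vec (Term S) n) {p q} → (p , q) ∈ diags ts → p ≡ q × ∣ p ∣ᵗ ≤ ∣ ts ∣ᵗˢ
    diags-diagonal (t ∷ ts) x∈ with ∈-++⁻ (diag t) x∈
    ... | inj₁ ∈t  = Product.map₂ (λ p≤ → ≤-trans p≤ (m≤m+n _ _)) (diag-diagonal t ∈t)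
    ... | inj₂ ∈ts = Product.map₂ (λ p≤ → ≤-trans p≤ (m≤n+m _ _)) (diags-diagonal ts ∈ts)

  mutual
    length-diag : ∀ t → length (diag {S} t) ≡ ∣ t ∣ᵗ
    length-diag (app f ts) = ≡.cong suc (length-diags ts)

    length-diags : ∀ {n} (ts : Vec (Term S) n) → length (diags ts) ≡ ∣ ts ∣ᵗˢ
    length-diags []       = refl
    length-diags (t ∷ ts) = ≡.trans (length-++ (diag t)) (≡.cong₂ _+_ (length-diag t) (length-diags ts))

  initial-axioms : ∀ Γ {x : Term S × Term S} → x ∈ Γ → x ∈ initial Γ
  initial-axioms ((p , q) ∷ Γ) (here refl) = here refl
  initial-axioms ((p , q) ∷ Γ) (there x∈)  = there (∈-++⁺ʳ (diag p) (∈-++⁺ʳ (diag q) (initial-axioms Γ x∈)))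

  initial-closed : ∀ Γ → Closed (initial Γ)
  initial-closed []            ()
  initial-closed ((p , q) ∷ Γ) = Closed-∷
    (∈-++⁺ˡ (diag-root p)) (∈-++⁺ʳ (diag p) (∈-++⁺ˡ (diag-root q)))
    (Closed-++ (diag-closed p) (Closed-++ (diag-closed q) (initial-closed Γ)))

  initial-∈⁻ : ∀ Γ {p q : Term S} → (p , q) ∈ initial Γ → ((p , q) ∈ Γ ⊎ p ≡ q) × ∣ p ∣ᵗ ≤ ∣ Γ ∣ᴳ × ∣ q ∣ᵗ ≤ ∣ Γ ∣ᴳ
  initial-∈⁻ ((p , q) ∷ Γ) (here refl) =
    inj₁ (here refl) , ≤-trans (m≤m+n _ _) (m≤m+n _ _) , ≤-trans (m≤n+m _ ∣ p ∣ᵗ) (m≤m+n _ _)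
  initial-∈⁻ ((p , q) ∷ Γ) (there x∈) with ∈-++⁻ (diag p) x∈
  ... | inj₁ ∈p with refl , s≤ ← diag-diagonal p ∈p =
    let s≤′ = ≤-trans s≤ (≤-trans (m≤m+n _ _) (m≤m+n _ _)) in inj₂ refl , s≤′ , s≤′
  ... | inj₂ x∈′ with ∈-++⁻ (diag q) x∈′
  ...   | inj₁ ∈q with refl , s≤ ← diag-diagonal q ∈q =
    let s≤′ = ≤-trans s≤ (≤-trans (m≤n+m _ ∣ p ∣ᵗ) (m≤m+n _ _)) in inj₂ refl , s≤′ , s≤′
  ...   | inj₂ ∈Γ with origin , p≤ , q≤ ← initial-∈⁻ Γ ∈Γ =
    Sum.map there id origin , ≤-trans p≤ (m≤n+m _ _) , ≤-trans q≤ (m≤n+m _ _)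

  -- An equation contributes one rule for each node of its two sides and one for itself; doubling
  -- covers the extra rule, since a term has at least one node.
  length-initial : ∀ Γ → length (initial {S} Γ) ≤ 2 * ∣ Γ ∣ᴳ
  length-initial []            = z≤n
  length-initial ((p , q) ∷ Γ) = begin
    suc (length (diag p ++ diag q ++ initial Γ))
      ≡⟨ ≡.cong suc (≡.trans (length-++ (diag p)) (≡.cong (length (diag p) +_) (length-++ (diag q)))) ⟩
    suc (length (diag p) + (length (diag q) + length (initial Γ)))
      ≡⟨ ≡.cong₂ (λ a b → suc (a + (b + length (initial Γ)))) (length-diag p) (length-diag q) ⟩
    1 + (∣ p ∣ᵗ + (∣ q ∣ᵗ + length (initial Γ)))
      ≤⟨ +-mono-≤ (≤-trans (1≤∣∣ p) (m≤m+n ∣ p ∣ᵗ ∣ q ∣ᵗ)) (+-monoʳ-≤ ∣ p ∣ᵗ (+-monoʳ-≤ ∣ q ∣ᵗ (length-initial Γ))) ⟩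
    ∣ p ∣ᵗ + ∣ q ∣ᵗ + (∣ p ∣ᵗ + (∣ q ∣ᵗ + 2 * ∣ Γ ∣ᴳ))               ≡⟨ rearrange ∣ p ∣ᵗ ∣ q ∣ᵗ ∣ Γ ∣ᴳ ⟩
    2 * (∣ p ∣ᵗ + ∣ q ∣ᵗ + ∣ Γ ∣ᴳ)                                   ∎
    where
    open ≤-Reasoning
    rearrange : ∀ a b c → a + b + (a + (b + 2 * c)) ≡ 2 * (a + b + c)
    rearrange = solve-∀

  -- The rules of `diag t` give `t` a state even if it does not occur in `Γ`. The final `[]` is the
  -- accumulator with which the program starts.
  rules : Equations S → Term S → Rules S
  rules Γ t = initial Γ ++ (diag t ++ [])

  rules-root : ∀ Γ t → (t , t) ∈ rules Γ t
  rules-root Γ t = ∈-++⁺ʳ (initial Γ) (∈-++⁺ˡ (diag-root t))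

  length-rules : ∀ Γ t → length (rules Γ t) ≤ 2 * (∣ Γ ∣ᴳ + ∣ t ∣ᵗ)
  length-rules Γ t = begin
    length (initial Γ ++ (diag t ++ []))
      ≡⟨ ≡.trans (length-++ (initial Γ)) (≡.cong (length (initial Γ) +_) (length-++ (diag t))) ⟩
    length (initial Γ) + (length (diag t) + 0)
      ≤⟨ +-mono-≤ (length-initial Γ) (+-mono-≤ (≤-reflexive (length-diag t)) z≤n) ⟩
    2 * ∣ Γ ∣ᴳ + (∣ t ∣ᵗ + ∣ t ∣ᵗ)              ≡⟨ rearrange ∣ Γ ∣ᴳ ∣ t ∣ᵗ ⟩
    2 * (∣ Γ ∣ᴳ + ∣ t ∣ᵗ)                       ∎
    where
    open ≤-Reasoning
    rearrange : ∀ a b → 2 * a + (b + b) ≡ 2 * (a + b)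
    rearrange = solve-∀

  rules-∈⁻ : ∀ Γ t {p q} → (p , q) ∈ rules Γ t →
             ((p , q) ∈ Γ ⊎ p ≡ q) × ∣ p ∣ᵗ ≤ ∣ Γ ∣ᴳ + ∣ t ∣ᵗ × ∣ q ∣ᵗ ≤ ∣ Γ ∣ᴳ + ∣ t ∣ᵗ
  rules-∈⁻ Γ t x∈ with ∈-++⁻ (initial Γ) x∈
  ... | inj₁ ∈Γ with origin , p≤ , q≤ ← initial-∈⁻ Γ ∈Γ =
    origin , ≤-trans p≤ (m≤m+n _ _) , ≤-trans q≤ (m≤m+n _ _)
  ... | inj₂ x∈′ with ∈-++⁻ (diag t) x∈′
  ...   | inj₁ ∈t with refl , s≤ ← diag-diagonal t ∈t =
    let s≤′ = ≤-trans s≤ (m≤n+m _ _) in inj₂ refl , s≤′ , s≤′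

  rules-start : ∀ Γ t → Start Γ (∣ Γ ∣ᴳ + ∣ t ∣ᵗ) (rules Γ t)
  rules-start Γ t = record
    { axioms  = λ pq∈ → ∈-++⁺ˡ (initial-axioms Γ pq∈)
    ; valid   = λ pq∈ → valid′ (proj₁ (rules-∈⁻ Γ t pq∈))
    ; closedˡ = λ pq∈ → proj₁ (closed pq∈)
    ; closedʳ = λ { {app f ps} pq∈ → proj₂ (closed pq∈) }
    ; smallˡ  = λ pq∈ → proj₁ (proj₂ (rules-∈⁻ Γ t pq∈))
    ; smallʳ  = λ pq∈ → proj₂ (proj₂ (rules-∈⁻ Γ t pq∈))
    }
    where
    closed : Closed (rules Γ t)
    closed = Closed-++ (initial-closed Γ) (Closed-++ (diag-closed t) λ ())
    valid′ : ∀ {p q} → (p , q) ∈ Γ ⊎ p ≡ q → Γ ⊢ p ∼ q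
    valid′ (inj₁ pq∈)  = axiom pq∈
    valid′ (inj₂ refl) = refl

  -- The two loops

  module Loops {Γ : Equations S} {N : ℕ} {Δ₀ : Rules S} (start : Start Γ N Δ₀)
               (M n : ℕ) (size≤M : ∀ (t : Term S) → ∣ t ∣ᵗ ≤ suc (N * N) → size t ≤ M) where
    open Start start
    open Semantics start
    open Costs M n

    module _ {σ Δ} (inv : Invariant σ Δ) where
      open Invariant inv

      ∣map∣≤ : ∀ {k} (ts : Vec (Term S) k) → ∣ ts ∣ᵗˢ ≤ N → ∣ Vec.map σ ts ∣ᵗˢ ≤ k * N
      ∣map∣≤ []       _   = z≤n
      ∣map∣≤ (t ∷ ts) ts≤ = +-mono-≤ (σ-bounded t (≤-trans (m≤m+n _ _) ts≤)) (∣map∣≤ ts (≤-trans (m≤n+m _ _) ts≤))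

      -- A root with fewer than `N` arguments, each of them renamed to a state of size at most `N`.
      ∣mapArgs∣≤ : ∀ t → ∣ t ∣ᵗ ≤ N → ∣ mapArgs σ t ∣ᵗ ≤ suc (N * N)
      ∣mapArgs∣≤ (app f ts) t≤ = s≤s (≤-trans (∣map∣≤ ts (<⇒≤ t≤))
        (*-monoˡ-≤ N (≤-trans (arity≤∣∣ ts) (<⇒≤ t≤))))

      invariant-small : Small M n Δ
      invariant-small = All.tabulate λ { {l , r} lr∈ → small (preimage lr∈) }
        where
        m≤m*m : ∀ {m} → m ≤ m * m
        m≤m*m {zero}  = z≤n
        m≤m*m {suc m} = m≤m+n _ _
        small : ∀ {l r} → ∃[ p ] ∃[ q ] (p , q) ∈ Δ₀ × l ≡ mapArgs σ p × r ≡ σ q → size l ≤ M × size r ≤ M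
        small (p , q , pq∈ , refl , refl) =
          size≤M (mapArgs σ p) (∣mapArgs∣≤ p (smallˡ pq∈))
          , size≤M (σ q) (m≤n⇒m≤1+n (≤-trans (σ-bounded q (smallʳ pq∈)) m≤m*m))

    -- The loop carries the current name `σ t` of the state of `t` and renames it together with the
    -- rules, so that the program never has to evaluate `σ`.
    record Closure (σ : Term S → Term S) (Δ : Rules S) (t : Term S) (k : ℕ) : Set where
      field
        {σ′}          : Term S → Term S
        {Δ′}          : Rules S
        invariant     : Invariant σ′ Δ′
        deterministic : Deterministic Δ′
        length≤       : length Δ′ ≤ n
        closes        : Call closeᶠ (encodeRules Δ ∷ encodeTerm (σ t) ∷ []) (encodeRules Δ′ ▹ encodeTerm (σ′ t))
                          (suc k * suc (findCost + subRulesCost + suc M))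

    close-call : ∀ k {σ Δ} → Invariant σ Δ → length Δ ≤ k → k ≤ n → ∀ t → Closure σ Δ t k
    close-call k {σ} {Δ} inv Δ≤ k≤ t with find-call M n Δ (invariant-small inv) (≤-trans Δ≤ k≤)
    ... | inj₂ (det , found) = record
      { invariant     = inv
      ; deterministic = det
      ; length≤       = ≤-trans Δ≤ k≤
      ; closes        = returns₁₊ (match-nilᴱ (callᴱ (varᴱ ∷ᴱ []ᴱ) found) (varᴱ ▹ᴱ varᴱ))
                          (≤-trans (m≤m+n _ subRulesCost) (m≤m+n _ (suc M)))
      }
    close-call zero {Δ = []} inv Δ≤ k≤ t | inj₁ (a , b , Δ₁ , () , found)
    close-call (suc k) {σ} {Δ} inv Δ≤ k≤ t | inj₁ (a , b , Δ₁ , dup , found) = record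
      { invariant     = invariant rest
      ; deterministic = deterministic rest
      ; length≤       = length≤ rest
      ; closes        = returns₄
          (match-pairᴱ (callᴱ (varᴱ ∷ᴱ []ᴱ) found) (match-pairᴱ varᴱ
            (callᴱ (callᴱ (varᴱ ∷ᴱ varᴱ ∷ᴱ varᴱ ∷ᴱ []ᴱ) (subRules-call M n a b a≤ Δ₁ Δ₁-small Δ₁≤)
                 ∷ᴱ callᴱ (varᴱ ∷ᴱ varᴱ ∷ᴱ varᴱ ∷ᴱ []ᴱ) (sub-call M n a b a≤ (σ t)) ∷ᴱ []ᴱ) (closes rest))))
          ≤-refl ≤-refl ≤-refl ≤-refl
      }
      where
      open Closure
      small = invariant-small inv

      a≤ : size a ≤ M
      a≤ with _ , la∈ , _ ← Duplicate-rules dup = proj₂ (All.lookup small la∈)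

      Δ₁-small : Small M n Δ₁
      Δ₁-small = All.tabulate λ x∈ → All.lookup small (Duplicate-⊆ dup x∈)

      Δ₁≤k : length Δ₁ ≤ k
      Δ₁≤k = ≤-pred (≤-trans (≤-reflexive (≡.sym (Duplicate-length dup))) Δ≤)

      Δ₁≤ : length Δ₁ ≤ n
      Δ₁≤ = ≤-trans Δ₁≤k (<⇒≤ k≤)

      rest : Closure (sub a b ∘ σ) (rename (sub a b) Δ₁) t k
      rest = close-call k (invariant-sub inv dup)
        (≤-trans (≤-reflexive (length-map _ Δ₁)) Δ₁≤k) (<⇒≤ k≤) t

    module _ {σ Δ} (inv : Invariant σ Δ) (det : Deterministic Δ) where
      open Automaton inv det

      record Tabulation (D : Table S) (k : ℕ) : Set where
        field
          {D′}    : Table S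
          counts  : Counts D′
          stuck   : ∀ {l r} → (l , r) ∈ Δ → assoc r D′ ≡ nothing → total D′ r Δ ≡ nothing
          length≤ : length D′ ≤ n
          tabulates : Call tableᶠ (encodeTable D ∷ encodeRules Δ ∷ []) (encodeTable D′) (suc k * suc readyCost)

      -- The list `U` contains all states that are still missing, possibly repeated. A round removes
      -- every copy of the state it enters, so the length of `U` drops and `k` bounds the remaining
      -- rounds; `length D + k ≤ n` keeps the table within `n` throughout.
      table-call : ∀ k {D} (U : List (Term S)) → Counts D → length U ≤ k → length D + k ≤ n →
        length Δ ≤ n → (∀ {l r} → (l , r) ∈ Δ → assoc r D ≡ nothing → r ∈ U) → Tabulation D k
      table-call k {D} U counts U≤ D≤ Δ≤ missing∈U
        with ready-call M n D (≤-trans (m≤m+n _ k) D≤) Δ (invariant-small inv) Δ≤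
      ... | inj₂ (none , c) = record
        { counts  = counts
        ; stuck   = none
        ; length≤ = ≤-trans (m≤m+n _ k) D≤
        ; tabulates = returns₁₊ (match-nilᴱ (callᴱ (varᴱ ∷ᴱ varᴱ ∷ᴱ varᴱ ∷ᴱ []ᴱ) c) varᴱ) ≤-refl
        }
      table-call zero {D} [] counts U≤ D≤ Δ≤ missing∈U | inj₁ (l , r , m , lr∈ , missing , tot , c)
        with () ← missing∈U lr∈ missing
      table-call (suc k) {D} U counts U≤ D≤ Δ≤ missing∈U | inj₁ (l , r , m , lr∈ , missing , tot , c) = record
        { counts  = Tabulation.counts rest
        ; stuck   = stuck rest
        ; length≤ = length≤ rest
        ; tabulates = returns₂
            (match-pairᴱ (callᴱ (varᴱ ∷ᴱ varᴱ ∷ᴱ varᴱ ∷ᴱ []ᴱ) c)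
              (callᴱ ((varᴱ ▹ᴱ varᴱ) ∷ᴱ varᴱ ∷ᴱ []ᴱ) (tabulates rest)))
            ≤-refl ≤-refl
        }
        where
        open Tabulation using (stuck; length≤; tabulates)
        other : (x : Term S) → Dec (x ≢ r)
        other x = ¬? (x ≟ r)

        missing′ : ∀ {l′ r′} → (l′ , r′) ∈ Δ → assoc r′ ((r , m) ∷ D) ≡ nothing → r′ ∈ filter other U
        missing′ {r′ = r′} x∈ eq with r′ ≟ r
        ... | no r′≢r = ∈-filter⁺ other (missing∈U x∈ eq) r′≢r

        rest : Tabulation ((r , m) ∷ D) k
        rest = table-call k (filter other U) (Counts-∷ counts tot)
          (≤-pred (≤-trans
            (filter-notAll other U (Any.map (λ r≡x x≢r → x≢r (≡.sym r≡x)) (missing∈U lr∈ missing))) U≤))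
          (≤-trans (≤-reflexive (≡.sym (+-suc (length D) k))) D≤)
          Δ≤ missing′

  -- The running time

  open Costs using (closeCost; tableCost; lookupCost)

  -- The calls made by the main expression in order of evaluation: `diag`, `initial`, `close`,
  -- `table`, `lookup`.
  mainCosts : (E M n : ℕ) → List ℕ
  mainCosts E M n = 2 * E ∷ 2 * E ∷ closeCost M n ∷ tableCost M n ∷ lookupCost M n ∷ []

  programTime : (E M n : ℕ) → ℕ
  programTime E M n = ‖ main countProgram ‖ + bodySize * sum (mainCosts E M n)

  module _ {M n : ℕ → ℕ} (M-poly : Polynomial M) (n-poly : Polynomial n) where

    lookupCost-polynomial : Polynomial (λ N → lookupCost (M N) (n N))
    lookupCost-polynomial = sucᴾ n-poly *ᴾ sucᴾ M-poly

    closeCost-polynomial : Polynomial (λ N → closeCost (M N) (n N))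
    closeCost-polynomial = sucᴾ n-poly *ᴾ sucᴾ (findCost-polynomial +ᴾ subRulesCost-polynomial +ᴾ sucᴾ M-poly)
      where
      findCost-polynomial     = sucᴾ n-poly *ᴾ sucᴾ lookupCost-polynomial
      subArgsCost-polynomial  = sucᴾ M-poly *ᴾ sucᴾ (sucᴾ M-poly)
      subRulesCost-polynomial = sucᴾ n-poly *ᴾ sucᴾ (subArgsCost-polynomial +ᴾ sucᴾ M-poly)

    tableCost-polynomial : Polynomial (λ N → tableCost (M N) (n N))
    tableCost-polynomial = sucᴾ n-poly *ᴾ sucᴾ readyCost-polynomial
      where
      productCost-polynomial = sucᴾ M-poly *ᴾ sucᴾ lookupCost-polynomial
      totalCost-polynomial   = sucᴾ n-poly *ᴾ sucᴾ (M-poly +ᴾ productCost-polynomial)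
      readyCost-polynomial   = sucᴾ n-poly *ᴾ sucᴾ (lookupCost-polynomial +ᴾ totalCost-polynomial)

    programTime-polynomial : ∀ {E : ℕ → ℕ} → Polynomial E → Polynomial (λ N → programTime (E N) (M N) (n N))
    programTime-polynomial E-poly = const-polynomial ‖ main countProgram ‖ +ᴾ const-polynomial bodySize *ᴾ
      (2E-poly +ᴾ (2E-poly +ᴾ (closeCost-polynomial +ᴾ (tableCost-polynomial
        +ᴾ (lookupCost-polynomial +ᴾ const-polynomial 0)))))
      where 2E-poly = const-polynomial 2 *ᴾ E-poly

  -- Values in terms of `N = ∣Γ∣ + ∣t∣` for the parameters `E`, `M` and `n`: they bound the code of
  -- `Γ` and of `t`, the code of a term with at most `1 + N * N` nodes, and the number of rules.
  maxEncoding maxSize maxLength : ℕ → ℕ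
  maxEncoding N = suc (nodeSize * N)
  maxSize N     = nodeSize * suc (N * N)
  maxLength N   = 2 * N

  maxEncoding-polynomial : Polynomial maxEncoding
  maxEncoding-polynomial = sucᴾ (const-polynomial nodeSize *ᴾ id-polynomial)

  maxSize-polynomial : Polynomial maxSize
  maxSize-polynomial = const-polynomial nodeSize *ᴾ sucᴾ (id-polynomial *ᴾ id-polynomial)

  maxLength-polynomial : Polynomial maxLength
  maxLength-polynomial = const-polynomial 2 *ᴾ id-polynomial

  -- Correctness of the program within polynomial time

  SolvesWithin : Equations S → Term S → ℕ → Set
  SolvesWithin Γ t k = ∃[ s ] ∃[ time ]
    ( HasSize (CongruenceClass Γ t) s
    × Runs countProgram (encodeInput Γ t) (encodeSize s) time
    × time ≤ k )

  countProgram-correct : ∀ Γ (t : Term S) (E M n : ℕ) →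
    size t ≤ E → ∣ encodeEquations Γ ∣ᵛ ≤ E →
    (∀ u → ∣ u ∣ᵗ ≤ suc ((∣ Γ ∣ᴳ + ∣ t ∣ᵗ) * (∣ Γ ∣ᴳ + ∣ t ∣ᵗ)) → size u ≤ M) →
    length (rules Γ t) ≤ n →
    SolvesWithin Γ t (programTime E M n)
  countProgram-correct Γ t E M n t≤ Γ≤ size≤M rules≤ = output (assoc (σ′ t) D′) refl
    where
    N = ∣ Γ ∣ᴳ + ∣ t ∣ᵗ

    start : Start Γ N (rules Γ t)
    start = rules-start Γ t

    open Semantics start
    open Loops start M n size≤M

    closure : Closure id (rules Γ t) t n
    closure = close-call n invariant-id rules≤ ≤-refl t

    open Closure closure

    tabulation : Tabulation invariant deterministic [] n
    -- At first every right-hand side is missing; there are no more of these than rules, so `n`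
    -- rounds suffice.
    tabulation = table-call invariant deterministic n (map proj₂ Δ′) (λ ())
      (≤-trans (≤-reflexive (length-map proj₂ Δ′)) length≤) ≤-refl length≤ (λ x∈ _ → ∈-map⁺ proj₂ x∈)

    open Tabulation tabulation using (D′; counts; stuck; tabulates) renaming (length≤ to D′≤)
    open Automaton invariant deterministic using (classSize)

    t∈ : (t , t) ∈ rules Γ t
    t∈ = rules-root Γ t

    σ′t≤ : size (σ′ t) ≤ M
    σ′t≤ = proj₂ (All.lookup (invariant-small invariant) (Invariant.image invariant t∈))

    costs : List ℕ
    costs = 2 * size t ∷ 2 * ∣ encodeEquations Γ ∣ᵛ ∷ closeCost M n ∷ tableCost M n ∷ lookupCost M n ∷ []

    costs≤ : sum costs ≤ sum (mainCosts E M n)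
    costs≤ = +-mono-≤ (*-monoʳ-≤ 2 t≤) (+-monoˡ-≤ _ (*-monoʳ-≤ 2 Γ≤))

    found : Call lookupᶠ (encodeTerm (σ′ t) ∷ encodeTable D′ ∷ [])
              (encodeMaybe num (assoc (σ′ t) D′)) (lookupCost M n)
    found = assoc-call M n num (σ′ t) D′ σ′t≤ D′≤

    output : ∀ m → assoc (σ′ t) D′ ≡ m → SolvesWithin Γ t (programTime E M n)
    output m eq = Maybe.maybe′ fin ∞ m , Eval.time evaluation , classSize t∈ counts stuck eq
      , Eval.derivation evaluation
      , ≤-trans (Eval.time≤ evaluation) (+-monoʳ-≤ ‖ main countProgram ‖ (*-monoʳ-≤ bodySize costs≤))
      where
      result : ∀ m → assoc (σ′ t) D′ ≡ m →
        Eval (encodeInput Γ t ∷ []) (main countProgram) (encodeSize (Maybe.maybe′ fin ∞ m)) costs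
      result m eq with assoc (σ′ t) D′ | found
      result _ refl | just _ | lk = match-pairᴱ varᴱ (match-pairᴱ
        (callᴱ (callᴱ (varᴱ ∷ᴱ callᴱ (varᴱ ∷ᴱ nilᴱ ∷ᴱ []ᴱ) (diag-call t []) ∷ᴱ []ᴱ)
          (initial-call Γ (diag t ++ [])) ∷ᴱ varᴱ ∷ᴱ []ᴱ) closes)
        (match-pairᴱ (callᴱ (varᴱ ∷ᴱ callᴱ (nilᴱ ∷ᴱ varᴱ ∷ᴱ []ᴱ) tabulates ∷ᴱ []ᴱ) lk) varᴱ))
      result _ refl | nothing | lk = match-pairᴱ varᴱ (match-pairᴱ
        (callᴱ (callᴱ (varᴱ ∷ᴱ callᴱ (varᴱ ∷ᴱ nilᴱ ∷ᴱ []ᴱ) (diag-call t []) ∷ᴱ []ᴱ)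
          (initial-call Γ (diag t ++ [])) ∷ᴱ varᴱ ∷ᴱ []ᴱ) closes)
        (match-nilᴱ (callᴱ (varᴱ ∷ᴱ callᴱ (nilᴱ ∷ᴱ varᴱ ∷ᴱ []ᴱ) tabulates ∷ᴱ []ᴱ) lk) nilᴱ))

      evaluation : Eval (encodeInput Γ t ∷ []) (main countProgram) (encodeSize (Maybe.maybe′ fin ∞ m)) costs
      evaluation = result m eq

  countProgram-polynomial : ∃[ c ] ∃[ d ] (∀ Γ t → SolvesWithin Γ t (c * (∣ Γ ∣ᴳ + ∣ t ∣ᵗ) ^ d))
  countProgram-polynomial =
    conclude (programTime-polynomial maxSize-polynomial maxLength-polynomial maxEncoding-polynomial)
    where
    relax : ∀ {Γ t k l} → k ≤ l → SolvesWithin Γ t k → SolvesWithin Γ t l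
    relax k≤l (s , time , hasSize , runs , time≤) = s , time , hasSize , runs , ≤-trans time≤ k≤l

    conclude : Polynomial (λ N → programTime (maxEncoding N) (maxSize N) (maxLength N)) →
               ∃[ c ] ∃[ d ] (∀ Γ t → SolvesWithin Γ t (c * (∣ Γ ∣ᴳ + ∣ t ∣ᵗ) ^ d))
    conclude (c , d , bound) = c , d , λ Γ t →
      -- The bound requires `1 ≤ N`, which holds because `t` has a node.
      relax (bound _ (≤-trans (1≤∣∣ t) (m≤n+m ∣ t ∣ᵗ ∣ Γ ∣ᴳ)))
        (countProgram-correct Γ t _ _ _
          (≤-trans (<⇒≤ (size<nodeSize*∣∣ t)) (m≤n⇒m≤1+n (*-monoʳ-≤ nodeSize (m≤n+m ∣ t ∣ᵗ ∣ Γ ∣ᴳ))))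
          (≤-trans (∣encodeEquations∣≤ Γ) (s≤s (*-monoʳ-≤ nodeSize (m≤m+n ∣ Γ ∣ᴳ ∣ t ∣ᵗ))))
          (λ u u≤ → ≤-trans (<⇒≤ (size<nodeSize*∣∣ u)) (*-monoʳ-≤ nodeSize u≤))
          (length-rules Γ t))

theorem3p8 : (S : Signature) →
    ∃[ P ] ∃[ c ] ∃[ d ] ((Γ : Equations S) (t : Term S) →
    ∃[ size ] ∃[ time ]
    ( HasSize (CongruenceClass Γ t) size
    × Runs P (encodeInput Γ t) (encodeSize size) time
    × time ≤ c * (∣ Γ ∣ᴳ + ∣ t ∣ᵗ) ^ d ))
theorem3p8 S = countProgram , countProgram-polynomial
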